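{- Let $M_1,M_2$ be proof terms of $\mathbf{IPC}$. If $M_1\to M_2$ in $\mathbf{IPC}$ (one step of the compatible closure of the union of all reduction rules of $\mathbf{IPC}$), then $M_1^{\bullet}\to^+_{\beta\eta\varepsilon\epsilon\delta}M_2^{\bullet}$ and $M_1^{\bullet}\to^+_{\beta\eta\varrho\rho}M_2^{\bullet}$ in system $\mathbf{F}$; moreover, these reductions are fine in $\Gamma^{\bullet}$ whenever $M_1$ is typable in $\Gamma$. More precisely, in the first case: (1) for $R\in\{\beta_\supset,\eta_\supset,\beta_\wedge,\eta_\wedge\}$: if $M_1\to_R M_2$ in $\mathbf{IPC}$ then $M_1^\bullet\to_R M_2^\bullet$ in $\mathbf{F}$; (2) if $M_1\to_{\beta_\vee}M_2$ in $\mathbf{IPC}$ then $M_1^\bullet\to_\beta^+M_2^\bullet$ in $\mathbf{F}$; (3) if $M_1\to_{\eta_\vee}M_2$ in $\mathbf{IPC}$ then $M_1^\bullet\to_{\eta\delta}^+M_2^\bullet$ in $\mathbf{F}$; (4) for $R\in\{\pi_\supset,\pi_\wedge,\pi_\vee,\pi_\perp\}$: if $M_1\to_RM_2$ in $\mathbf{IPC}$ then $M_1^\bullet\to_{\varepsilon}^+M_2^\bullet$ in $\mathbf{F}$; (5) for $R\in\{\varpi_\supset,\varpi_\wedge,\varpi_\vee,\varpi_\perp\}$: if $M_1\to_RM_2$ in $\mathbf{IPC}$ then $M_1^\bullet\to_{\epsilon}^+M_2^\bullet$ in $\mathbf{F}$.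
   Context: **$\mathbf{IPC}$.** Types: $A,B,C::=X\mid\perp\mid A\supset B\mid A\wedge B\mid A\vee B$. Proof terms (raw, up to $\alpha$-equivalence): $x$, $\lambda x^A.M$, $MN$, $\langle M,N\rangle$, $M1$, $M2$ (projections), $\mathsf{in}_1(M,A,B)$, $\mathsf{in}_2(N,A,B)$, $\mathsf{case}(M,x^A.P,y^B.Q,C)$, $\mathsf{abort}(M,A)$. Typing is the usual natural deduction typing; $\mathsf{in}_i(M,A_1,A_2):A_1\vee A_2$ if $M:A_i$; $\Gamma\vdash\mathsf{case}(M,x^A.P,y^B.Q,C):C$ if $\Gamma\vdash M:A\vee B$, $\Gamma,x:A\vdash P:C$, $\Gamma,y:B\vdash Q:C$; $\mathsf{abort}(M,A):A$ if $M:\perp$. Reduction rules of $\mathbf{IPC}$ ($i\in\{1,2\}$; bound variables chosen to avoid capture): $\beta_\supset$: $(\lambda x^A.M)N\to[N/x]M$; $\beta_\wedge$: $\langle M_1,M_2\rangle i\to M_i$; $\beta_\vee$: $\mathsf{case}(\mathsf{in}_i(M,A_1,A_2),x_1^{A_1}.P_1,x_2^{A_2}.P_2,C)\to[M/x_i]P_i$; $\pi_\supset$: $\mathsf{case}(M,x.P,y.Q,C\supset D)N\to\mathsf{case}(M,x.PN,y.QN,D)$; $\pi_\wedge$: $\mathsf{case}(M,x.P,y.Q,C_1\wedge C_2)i\to\mathsf{case}(M,x.Pi,y.Qi,C_i)$; $\pi_\vee$: $\mathsf{case}(\mathsf{case}(M,x'.P',y'.Q',C\vee D),x^C.P,y^D.Q,E)\to\mathsf{case}(M,x'.\mathsf{case}(P',x^C.P,y^D.Q,E),y'.\mathsf{case}(Q',x^C.P,y^D.Q,E),E)$;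 $\pi_\perp$: $\mathsf{abort}(\mathsf{case}(M,x.P,y.Q,\perp),C)\to\mathsf{case}(M,x.\mathsf{abort}(P,C),y.\mathsf{abort}(Q,C),C)$; $\varpi_\supset$: $\mathsf{abort}(M,C\supset D)N\to\mathsf{abort}(M,D)$; $\varpi_\wedge$: $\mathsf{abort}(M,C_1\wedge C_2)i\to\mathsf{abort}(M,C_i)$; $\varpi_\vee$: $\mathsf{case}(\mathsf{abort}(M,C\vee D),x^C.P,y^D.Q,E)\to\mathsf{abort}(M,E)$; $\varpi_\perp$: $\mathsf{abort}(\mathsf{abort}(M,\perp),C)\to\mathsf{abort}(M,C)$; $\eta_\supset$: $\lambda x^A.Mx\to M$ ($x\notin M$); $\eta_\wedge$: $\langle M1,M2\rangle\to M$; $\eta_\vee$: $\mathsf{case}(M,x^A.\mathsf{in}_1(x,A,B),y^B.\mathsf{in}_2(y,A,B),A\vee B)\to M$. **System $\mathbf{F}$** (Church style, primitive conjunction). Types: $A,B::=X\mid A\supset B\mid A\wedge B\mid\forall X.A$. Terms (raw, not assumed typable, up to $\alpha$-equivalence): $x$, $\lambda x^A.M$, $MN$, $\langle M,N\rangle$, $M1$, $M2$, $\Lambda X.M$, $MB$ ($B$ a type). Application associates to the left; $\langle P_i\rangle_{i=1,2}$ is $\langle P_1,P_2\rangle$; $x\notin M$, $X\notin M$ mean "not free in". Environments $\Gamma$ are sets of declarations $x:A$, each variable declared at most once. Typing: usual rules for $\supset,\wedge$; $\forall I$: from $\Gamma\vdash M:A$ infer $\Gamma\vdash\Lambda X.M:\forall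 X.A$ if $X$ is free in no type of $\Gamma$; $\forall E$: from $\Gamma\vdash M:\forall X.A$ infer $\Gamma\vdash MB:[B/X]A$. "$M$ has type $A$ in $\Gamma$" means $\Gamma\vdash M:A$ is derivable; "typable in $\Gamma$" means it has some type in $\Gamma$. In $\mathbf{F}$, $\beta$ consists of $\beta_\supset$: $(\lambda x^A.M)N\to[N/x]M$, $\beta_\wedge$: $\langle M_1,M_2\rangle i\to M_i$ ($i\in\{1,2\}$), and $\beta_\forall$: $(\Lambda X.M)B\to[B/X]M$; $\eta$ consists of $\eta_\supset$: $\lambda x^A.Mx\to M$ ($x\notin M$), $\eta_\wedge$: $\langle M1,M2\rangle\to M$, and $\eta_\forall$: $\Lambda X.MX\to M$ ($X\notin M$). Abbreviations: $A\,\underline{\vee}\,B:=\forall X.((A\supset X)\wedge(B\supset X))\supset X$ ($X\notin A,B$), $\underline{\perp}:=\forall X.X$. **Extra conversions in $\mathbf{F}$** (bound variables of the contractum chosen fresh, so that no capture occurs). $\varrho$: $M(C_1\supset C_2)\langle\lambda x^A.P,\lambda y^B.Q\rangle\to\lambda z^{C_1}.MC_2\langle\lambda x^A.Pz,\lambda y^B.Qz\rangle$; $M(C_1\wedge C_2)\langle\lambda x^A.P,\lambda y^B.Q\rangle\to\langle MC_i\langle\lambda x^A.Pi,\lambda y^B.Qi\rangle\rangle_{i=1,2}$; $M(\forall Y.D)\langle\lambda x^A.P,\lambda y^B.Q\rangle\to\Lambda Y.MD\langle\lambda x^A.PY,\lambda y^B.QY\rangle$. $\rho$: $M(C_1\supset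 C_2)\to\lambda z^{C_1}.MC_2$; $M(C_1\wedge C_2)\to\langle MC_i\rangle_{i=1,2}$; $M(\forall Y.D)\to\Lambda Y.MD$. $\delta$: $M(C_1\supset C_2)\langle\lambda x^A\lambda z^{C_1}.P,\lambda y^B\lambda z^{C_1}.Q\rangle\to\lambda z^{C_1}.MC_2\langle\lambda x^A.P,\lambda y^B.Q\rangle$; $M(C_1\wedge C_2)\langle\lambda x^A.\langle P_i\rangle_{i=1,2},\lambda y^B.\langle Q_i\rangle_{i=1,2}\rangle\to\langle MC_i\langle\lambda x^A.P_i,\lambda y^B.Q_i\rangle\rangle_{i=1,2}$; $M(\forall Y.D)\langle\lambda x^A\Lambda Y.P,\lambda y^B\Lambda Y.Q\rangle\to\Lambda Y.MD\langle\lambda x^A.P,\lambda y^B.Q\rangle$. $\varepsilon$: $M(C_1\supset C_2)\langle\lambda x^A.P,\lambda y^B.Q\rangle N\to MC_2\langle\lambda x^A.PN,\lambda y^B.QN\rangle$; $M(C_1\wedge C_2)\langle\lambda x^A.P,\lambda y^B.Q\rangle i\to MC_i\langle\lambda x^A.Pi,\lambda y^B.Qi\rangle$; $M(\forall Y.C')\langle\lambda x^A.P,\lambda y^B.Q\rangle C''\to M([C''/Y]C')\langle\lambda x^A.PC'',\lambda y^B.QC''\rangle$. $\epsilon$: $M(C_1\supset C_2)N\to MC_2$; $M(C_1\wedge C_2)i\to MC_i$; $M(\forall Y.C')C''\to M([C''/Y]C')$. For a set $R$ of rules (juxtaposition means union), $\to_R$ is the compatible closure of $R$ and $\to_R^+$,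 $\to_R^*$ its transitive and reflexive-transitive closures. **Fineness.** A root $\beta$- or $\eta$-reduction is fine in every environment. A root $\varrho$-, $\delta$- or $\varepsilon$-reduction, whose redex consists of a head term $M$ applied to a type $C$ and then to a pair of the form $\langle\lambda x^A.P,\lambda y^B.Q\rangle$ (followed, in the case of $\varepsilon$, by one further elimination), is fine in $\Gamma$ if $M$ has type $A\,\underline{\vee}\,B$ in $\Gamma$; a root $\rho$- or $\epsilon$-reduction, whose redex consists of a head term $M$ applied to a type $C$ (followed, in the case of $\epsilon$, by one further elimination), is fine in $\Gamma$ if $M$ has type $\underline{\perp}$ in $\Gamma$. "$M\to_RM'$ is fine in $\Gamma$" is the ternary relation inductively generated from the fine root $R$-reductions by: if $M\to M'$ is fine in $x:A,\Gamma$ then $\lambda x^A.M\to\lambda x^A.M'$ is fine in $\Gamma$; and, if $M\to M'$ is fine in $\Gamma$, then so are $MN\to M'N$, $NM\to NM'$, $\langle M,N\rangle\to\langle M',N\rangle$, $\langle N,M\rangle\to\langle N,M'\rangle$, $Mi\to M'i$, $\Lambda X.M\to\Lambda X.M'$, $MB\to M'B$. "$M\to_R^+M'$ (resp. $\to_R^*$) is fine in $\Gamma$" is the transitive (resp. reflexive-transitive) closure for fixed $\Gamma$. **Russell-Prawitz translation.** On types: $X^\bullet=X$, $\perp^\bullet=\underline{\perp}$, $(A\supset B)^\bullet=A^\bullet\supset B^\bullet$, $(A\wedge B)^\bullet=A^\bullet\wedge B^\bullet$, $(A\vee B)^\bullet=A^\bullet\,\underline{\vee}\,B^\bullet$. On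 terms it is homomorphic on variables, $\lambda$ (with $(\lambda x^A.M)^\bullet=\lambda x^{A^\bullet}.M^\bullet$), application, pairs and projections, and $(\mathsf{in}_i(M,A,B))^\bullet=\Lambda X.\lambda w^{(A^\bullet\supset X)\wedge(B^\bullet\supset X)}.(w\,i)M^\bullet$ ($X$, $w$ fresh), $(\mathsf{case}(M,x^A.P,y^B.Q,C))^\bullet=M^\bullet C^\bullet\langle\lambda x^{A^\bullet}.P^\bullet,\lambda y^{B^\bullet}.Q^\bullet\rangle$, $(\mathsf{abort}(M,A))^\bullet=M^\bullet A^\bullet$. $\Gamma^\bullet$ is obtained by translating all types in $\Gamma$. -}

module Defs where

open import Data.Fin using (Fin; zero; suc; lift)
open import Data.Nat using (ℕ; suc)
open import Data.Product using (_×_; ∃)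
open import Data.Unit using (⊤)
open import Data.Vec using (Vec; []; _∷_; lookup; map)
import Data.Vec.Functional as Sub
open import Function using (_∘_)
open import Relation.Binary.Construct.Closure.Transitive using (TransClosure)
open import Relation.Unary using (Pred; _∈_; _∪_; ｛_｝; U)
open import Level using (0ℓ)

-- Both calculi are presented with well-scoped de Bruijn indices: k counts the
-- type variables in scope and n the term variables.  Terms are raw (untyped).
-- An environment declares exactly the n term variables in scope.

private
  variable
    k l m n : ℕ

-- The index i of a projection M i and of an injection inᵢ.

data Index : Set where
  𝟏 𝟐 : Index

pick : ∀ {a} {A : Set a} → Index → A → A → A
pick 𝟏 x y = x
pick 𝟐 x y = y

module IPC where

  infixr 6 _⊃_
  infixr 7 _∨_
  infixr 8 _∧_
  infixl 9 _·_ _·ᵖ_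
  infix 4 _⊢_∶_ _⟶[_]_ _⟶_

  data Ty (k : ℕ) : Set where
    var         : Fin k → Ty k
    ⊥           : Ty k
    _⊃_ _∧_ _∨_ : Ty k → Ty k → Ty k

  data Tm (k n : ℕ) : Set where
    var   : Fin n → Tm k n
    ƛ     : Ty k → Tm k (suc n) → Tm k n
    _·_   : Tm k n → Tm k n → Tm k n
    ⟨_,_⟩ : Tm k n → Tm k n → Tm k n
    _·ᵖ_  : Tm k n → Index → Tm k n
    in′   : Index → Tm k n → Ty k → Ty k → Tm k n
    case  : Tm k n → Ty k → Tm k (suc n) → Ty k → Tm k (suc n) → Ty k → Tm k n
    abort : Tm k n → Ty k → Tm k n

  ren : (Fin n → Fin m) → Tm k n → Tm k m
  ren ξ (var x)            = var (ξ x)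
  ren ξ (ƛ A M)            = ƛ A (ren (lift 1 ξ) M)
  ren ξ (M · N)            = ren ξ M · ren ξ N
  ren ξ ⟨ M , N ⟩          = ⟨ ren ξ M , ren ξ N ⟩
  ren ξ (M ·ᵖ i)           = ren ξ M ·ᵖ i
  ren ξ (in′ i M A B)      = in′ i (ren ξ M) A B
  ren ξ (case M A P B Q C) = case (ren ξ M) A (ren (lift 1 ξ) P) B (ren (lift 1 ξ) Q) C
  ren ξ (abort M A)        = abort (ren ξ M) A

  wk : Tm k n → Tm k (suc n)
  wk = ren suc

  -- Weakening below one bound variable.
  wk₁ : Tm k (suc n) → Tm k (suc (suc n))
  wk₁ = ren (lift 1 suc)

  exts : (Fin n → Tm k m) → Fin (suc n) → Tm k (suc m)
  exts σ = var zero Sub.∷ (wk ∘ σ)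

  sub : (Fin n → Tm k m) → Tm k n → Tm k m
  sub σ (var x)            = σ x
  sub σ (ƛ A M)            = ƛ A (sub (exts σ) M)
  sub σ (M · N)            = sub σ M · sub σ N
  sub σ ⟨ M , N ⟩          = ⟨ sub σ M , sub σ N ⟩
  sub σ (M ·ᵖ i)           = sub σ M ·ᵖ i
  sub σ (in′ i M A B)      = in′ i (sub σ M) A B
  sub σ (case M A P B Q C) = case (sub σ M) A (sub (exts σ) P) B (sub (exts σ) Q) C
  sub σ (abort M A)        = abort (sub σ M) A

  _[_] : Tm k (suc n) → Tm k n → Tm k n
  M [ N ] = sub (N Sub.∷ var) M

  Env : ℕ → ℕ → Set
  Env k n = Vec (Ty k) n

  data _⊢_∶_ {k n} (Γ : Env k n) : Tm k n → Ty k → Set where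
    ⊢var   : ∀ x → Γ ⊢ var x ∶ lookup Γ x
    ⊢ƛ     : ∀ {A B M} → A ∷ Γ ⊢ M ∶ B → Γ ⊢ ƛ A M ∶ A ⊃ B
    ⊢·     : ∀ {A B M N} → Γ ⊢ M ∶ A ⊃ B → Γ ⊢ N ∶ A → Γ ⊢ M · N ∶ B
    ⊢⟨,⟩   : ∀ {A B M N} → Γ ⊢ M ∶ A → Γ ⊢ N ∶ B → Γ ⊢ ⟨ M , N ⟩ ∶ A ∧ B
    ⊢·ᵖ    : ∀ {A B M} i → Γ ⊢ M ∶ A ∧ B → Γ ⊢ M ·ᵖ i ∶ pick i A B
    ⊢in    : ∀ {A B M} i → Γ ⊢ M ∶ pick i A B → Γ ⊢ in′ i M A B ∶ A ∨ B
    ⊢case  : ∀ {A B C M P Q} → Γ ⊢ M ∶ A ∨ B → A ∷ Γ ⊢ P ∶ C → B ∷ Γ ⊢ Q ∶ C →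
             Γ ⊢ case M A P B Q C ∶ C
    ⊢abort : ∀ {A M} → Γ ⊢ M ∶ ⊥ → Γ ⊢ abort M A ∶ A

  Typable : Env k n → Tm k n → Set
  Typable Γ M = ∃ λ A → Γ ⊢ M ∶ A

  data Rule : Set where
    β⊃ β∧ β∨ π⊃ π∧ π∨ π⊥ ϖ⊃ ϖ∧ ϖ∨ ϖ⊥ η⊃ η∧ η∨ : Rule

  π ϖ : Pred Rule 0ℓ
  π = ｛ π⊃ ｝ ∪ ｛ π∧ ｝ ∪ ｛ π∨ ｝ ∪ ｛ π⊥ ｝
  ϖ = ｛ ϖ⊃ ｝ ∪ ｛ ϖ∧ ｝ ∪ ｛ ϖ∨ ｝ ∪ ｛ ϖ⊥ ｝

  data Root {k n} : Rule → Tm k n → Tm k n → Set where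
    β⊃ : ∀ {A M N} → Root β⊃ (ƛ A M · N) (M [ N ])
    β∧ : ∀ {M₁ M₂} i → Root β∧ (⟨ M₁ , M₂ ⟩ ·ᵖ i) (pick i M₁ M₂)
    β∨ : ∀ {A₁ A₂ M P₁ P₂ C} i →
         Root β∨ (case (in′ i M A₁ A₂) A₁ P₁ A₂ P₂ C) (pick i P₁ P₂ [ M ])
    π⊃ : ∀ {A B C D M P Q N} →
         Root π⊃ (case M A P B Q (C ⊃ D) · N)
                 (case M A (P · wk N) B (Q · wk N) D)
    π∧ : ∀ {A B C₁ C₂ M P Q} i →
         Root π∧ (case M A P B Q (C₁ ∧ C₂) ·ᵖ i)
                 (case M A (P ·ᵖ i) B (Q ·ᵖ i) (pick i C₁ C₂))
    π∨ : ∀ {A B C D E M P′ Q′ P Q} →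
         Root π∨ (case (case M A P′ B Q′ (C ∨ D)) C P D Q E)
                 (case M A (case P′ C (wk₁ P) D (wk₁ Q) E)
                         B (case Q′ C (wk₁ P) D (wk₁ Q) E) E)
    π⊥ : ∀ {A B C M P Q} →
         Root π⊥ (abort (case M A P B Q ⊥) C)
                 (case M A (abort P C) B (abort Q C) C)
    ϖ⊃ : ∀ {C D M N} → Root ϖ⊃ (abort M (C ⊃ D) · N) (abort M D)
    ϖ∧ : ∀ {C₁ C₂ M} i → Root ϖ∧ (abort M (C₁ ∧ C₂) ·ᵖ i) (abort M (pick i C₁ C₂))
    ϖ∨ : ∀ {C D E M P Q} → Root ϖ∨ (case (abort M (C ∨ D)) C P D Q E) (abort M E)
    ϖ⊥ : ∀ {C M} → Root ϖ⊥ (abort (abort M ⊥) C) (abort M C)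
    η⊃ : ∀ {A M} → Root η⊃ (ƛ A (wk M · var zero)) M
    η∧ : ∀ {M} → Root η∧ ⟨ M ·ᵖ 𝟏 , M ·ᵖ 𝟐 ⟩ M
    η∨ : ∀ {A B M} →
         Root η∨ (case M A (in′ 𝟏 (var zero) A B) B (in′ 𝟐 (var zero) A B) (A ∨ B)) M

  data Step (R : Pred Rule 0ℓ) {k n} : Tm k n → Tm k n → Set where
    root   : ∀ {r M M′} → r ∈ R → Root r M M′ → Step R M M′
    ξƛ     : ∀ {A M M′} → Step R M M′ → Step R (ƛ A M) (ƛ A M′)
    ξ·ˡ    : ∀ {M M′ N} → Step R M M′ → Step R (M · N) (M′ · N)
    ξ·ʳ    : ∀ {M M′ N} → Step R M M′ → Step R (N · M) (N · M′)
    ξ⟨,⟩ˡ  : ∀ {M M′ N} → Step R M M′ → Step R ⟨ M , N ⟩ ⟨ M′ , N ⟩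
    ξ⟨,⟩ʳ  : ∀ {M M′ N} → Step R M M′ → Step R ⟨ N , M ⟩ ⟨ N , M′ ⟩
    ξ·ᵖ    : ∀ {M M′ i} → Step R M M′ → Step R (M ·ᵖ i) (M′ ·ᵖ i)
    ξin′   : ∀ {M M′ i A B} → Step R M M′ → Step R (in′ i M A B) (in′ i M′ A B)
    ξcase₀ : ∀ {M M′ A B C P Q} → Step R M M′ → Step R (case M A P B Q C) (case M′ A P B Q C)
    ξcase₁ : ∀ {M A B C P P′ Q} → Step R P P′ → Step R (case M A P B Q C) (case M A P′ B Q C)
    ξcase₂ : ∀ {M A B C P Q Q′} → Step R Q Q′ → Step R (case M A P B Q C) (case M A P B Q′ C)
    ξabort : ∀ {M M′ A} → Step R M M′ → Step R (abort M A) (abort M′ A)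

  _⟶[_]_ : Tm k n → Pred Rule 0ℓ → Tm k n → Set
  M ⟶[ R ] M′ = Step R M M′

  _⟶_ : Tm k n → Tm k n → Set
  M ⟶ M′ = M ⟶[ U ] M′

module F where

  infixr 6 _⊃_
  infixr 7 _∨̲_
  infixr 8 _∧_
  infixr 5 ∀′_
  infixl 9 _·_ _·ᵖ_ _·ᵗ_
  infix 4 _⊢_∶_ _⟶[_]_ _⟶⁺[_]_ _⊢_⟶[_]_ _⊢_⟶⁺[_]_

  data Ty (k : ℕ) : Set where
    var     : Fin k → Ty k
    _⊃_ _∧_ : Ty k → Ty k → Ty k
    ∀′_     : Ty (suc k) → Ty k

  renTy : (Fin k → Fin l) → Ty k → Ty l
  renTy ξ (var X) = var (ξ X)
  renTy ξ (A ⊃ B) = renTy ξ A ⊃ renTy ξ B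
  renTy ξ (A ∧ B) = renTy ξ A ∧ renTy ξ B
  renTy ξ (∀′ A)  = ∀′ renTy (lift 1 ξ) A

  wkTy : Ty k → Ty (suc k)
  wkTy = renTy suc

  extsTy : (Fin k → Ty l) → Fin (suc k) → Ty (suc l)
  extsTy σ = var zero Sub.∷ (wkTy ∘ σ)

  subTy : (Fin k → Ty l) → Ty k → Ty l
  subTy σ (var X) = σ X
  subTy σ (A ⊃ B) = subTy σ A ⊃ subTy σ B
  subTy σ (A ∧ B) = subTy σ A ∧ subTy σ B
  subTy σ (∀′ A)  = ∀′ subTy (extsTy σ) A

  _[_]Ty : Ty (suc k) → Ty k → Ty k
  A [ B ]Ty = subTy (B Sub.∷ var) A

  _∨̲_ : Ty k → Ty k → Ty k
  A ∨̲ B = ∀′ ((wkTy A ⊃ var zero) ∧ (wkTy B ⊃ var zero)) ⊃ var zero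

  ⊥̲ : Ty k
  ⊥̲ = ∀′ var zero

  data Tm (k n : ℕ) : Set where
    var   : Fin n → Tm k n
    ƛ     : Ty k → Tm k (suc n) → Tm k n
    _·_   : Tm k n → Tm k n → Tm k n
    ⟨_,_⟩ : Tm k n → Tm k n → Tm k n
    _·ᵖ_  : Tm k n → Index → Tm k n
    Λ     : Tm (suc k) n → Tm k n
    _·ᵗ_  : Tm k n → Ty k → Tm k n

  ren : (Fin n → Fin m) → Tm k n → Tm k m
  ren ξ (var x)   = var (ξ x)
  ren ξ (ƛ A M)   = ƛ A (ren (lift 1 ξ) M)
  ren ξ (M · N)   = ren ξ M · ren ξ N
  ren ξ ⟨ M , N ⟩ = ⟨ ren ξ M , ren ξ N ⟩
  ren ξ (M ·ᵖ i)  = ren ξ M ·ᵖ i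
  ren ξ (Λ M)     = Λ (ren ξ M)
  ren ξ (M ·ᵗ B)  = ren ξ M ·ᵗ B

  wk : Tm k n → Tm k (suc n)
  wk = ren suc

  -- Weakening below one bound variable.
  wk₁ : Tm k (suc n) → Tm k (suc (suc n))
  wk₁ = ren (lift 1 suc)

  -- Exchange of the two innermost variables.
  swap : Tm k (suc (suc n)) → Tm k (suc (suc n))
  swap = ren exchange
    where
    exchange : Fin (suc (suc n)) → Fin (suc (suc n))
    exchange zero          = suc zero
    exchange (suc zero)    = zero
    exchange (suc (suc x)) = suc (suc x)

  renᵗ : (Fin k → Fin l) → Tm k n → Tm l n
  renᵗ ξ (var x)   = var x
  renᵗ ξ (ƛ A M)   = ƛ (renTy ξ A) (renᵗ ξ M)
  renᵗ ξ (M · N)   = renᵗ ξ M · renᵗ ξ N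
  renᵗ ξ ⟨ M , N ⟩ = ⟨ renᵗ ξ M , renᵗ ξ N ⟩
  renᵗ ξ (M ·ᵖ i)  = renᵗ ξ M ·ᵖ i
  renᵗ ξ (Λ M)     = Λ (renᵗ (lift 1 ξ) M)
  renᵗ ξ (M ·ᵗ B)  = renᵗ ξ M ·ᵗ renTy ξ B

  wkᵗ : Tm k n → Tm (suc k) n
  wkᵗ = renᵗ suc

  exts : (Fin n → Tm k m) → Fin (suc n) → Tm k (suc m)
  exts σ = var zero Sub.∷ (wk ∘ σ)

  sub : (Fin n → Tm k m) → Tm k n → Tm k m
  sub σ (var x)   = σ x
  sub σ (ƛ A M)   = ƛ A (sub (exts σ) M)
  sub σ (M · N)   = sub σ M · sub σ N
  sub σ ⟨ M , N ⟩ = ⟨ sub σ M , sub σ N ⟩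
  sub σ (M ·ᵖ i)  = sub σ M ·ᵖ i
  sub σ (Λ M)     = Λ (sub (wkᵗ ∘ σ) M)
  sub σ (M ·ᵗ B)  = sub σ M ·ᵗ B

  _[_] : Tm k (suc n) → Tm k n → Tm k n
  M [ N ] = sub (N Sub.∷ var) M

  subᵗ : (Fin k → Ty l) → Tm k n → Tm l n
  subᵗ σ (var x)   = var x
  subᵗ σ (ƛ A M)   = ƛ (subTy σ A) (subᵗ σ M)
  subᵗ σ (M · N)   = subᵗ σ M · subᵗ σ N
  subᵗ σ ⟨ M , N ⟩ = ⟨ subᵗ σ M , subᵗ σ N ⟩
  subᵗ σ (M ·ᵖ i)  = subᵗ σ M ·ᵖ i
  subᵗ σ (Λ M)     = Λ (subᵗ (extsTy σ) M)
  subᵗ σ (M ·ᵗ B)  = subᵗ σ M ·ᵗ subTy σ B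

  _[_]ᵗ : Tm (suc k) n → Ty k → Tm k n
  M [ B ]ᵗ = subᵗ (B Sub.∷ var) M

  Env : ℕ → ℕ → Set
  Env k n = Vec (Ty k) n

  -- In ⊢Λ the premise lives over the weakened environment: the bound type
  -- variable is free in no type of Γ.
  data _⊢_∶_ {k n} (Γ : Env k n) : Tm k n → Ty k → Set where
    ⊢var : ∀ x → Γ ⊢ var x ∶ lookup Γ x
    ⊢ƛ   : ∀ {A B M} → A ∷ Γ ⊢ M ∶ B → Γ ⊢ ƛ A M ∶ A ⊃ B
    ⊢·   : ∀ {A B M N} → Γ ⊢ M ∶ A ⊃ B → Γ ⊢ N ∶ A → Γ ⊢ M · N ∶ B
    ⊢⟨,⟩ : ∀ {A B M N} → Γ ⊢ M ∶ A → Γ ⊢ N ∶ B → Γ ⊢ ⟨ M , N ⟩ ∶ A ∧ B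
    ⊢·ᵖ  : ∀ {A B M} i → Γ ⊢ M ∶ A ∧ B → Γ ⊢ M ·ᵖ i ∶ pick i A B
    ⊢Λ   : ∀ {A M} → map wkTy Γ ⊢ M ∶ A → Γ ⊢ Λ M ∶ ∀′ A
    ⊢·ᵗ  : ∀ {A M} B → Γ ⊢ M ∶ ∀′ A → Γ ⊢ M ·ᵗ B ∶ A [ B ]Ty

  data Rule : Set where
    β⊃ β∧ β∀ η⊃ η∧ η∀ ϱ ρ δ ε ϵ : Rule

  β η : Pred Rule 0ℓ
  β = ｛ β⊃ ｝ ∪ ｛ β∧ ｝ ∪ ｛ β∀ ｝
  η = ｛ η⊃ ｝ ∪ ｛ η∧ ｝ ∪ ｛ η∀ ｝

  data Root {k n} : Rule → Tm k n → Tm k n → Set where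
    β⊃ : ∀ {A M N} → Root β⊃ (ƛ A M · N) (M [ N ])
    β∧ : ∀ {M₁ M₂} i → Root β∧ (⟨ M₁ , M₂ ⟩ ·ᵖ i) (pick i M₁ M₂)
    β∀ : ∀ {M B} → Root β∀ (Λ M ·ᵗ B) (M [ B ]ᵗ)

    η⊃ : ∀ {A M} → Root η⊃ (ƛ A (wk M · var zero)) M
    η∧ : ∀ {M} → Root η∧ ⟨ M ·ᵖ 𝟏 , M ·ᵖ 𝟐 ⟩ M
    η∀ : ∀ {M} → Root η∀ (Λ (wkᵗ M ·ᵗ var zero)) M

    -- In ϱ⊃ and δ⊃ the contractum binds z outside x (resp. y), so there z has
    -- index 1 and x (resp. y) has index 0; in the redex of δ⊃ it is the reverse.
    ϱ⊃ : ∀ {C₁ C₂} M A P B Q →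
         Root ϱ (M ·ᵗ (C₁ ⊃ C₂) · ⟨ ƛ A P , ƛ B Q ⟩)
                (ƛ C₁ (wk M ·ᵗ C₂ · ⟨ ƛ A (wk₁ P · var (suc zero))
                                    , ƛ B (wk₁ Q · var (suc zero)) ⟩))
    ϱ∧ : ∀ {C₁ C₂} M A P B Q →
         Root ϱ (M ·ᵗ (C₁ ∧ C₂) · ⟨ ƛ A P , ƛ B Q ⟩)
                ⟨ M ·ᵗ C₁ · ⟨ ƛ A (P ·ᵖ 𝟏) , ƛ B (Q ·ᵖ 𝟏) ⟩
                , M ·ᵗ C₂ · ⟨ ƛ A (P ·ᵖ 𝟐) , ƛ B (Q ·ᵖ 𝟐) ⟩ ⟩
    ϱ∀ : ∀ {D} M A P B Q →
         Root ϱ (M ·ᵗ (∀′ D) · ⟨ ƛ A P , ƛ B Q ⟩)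
                (Λ (wkᵗ M ·ᵗ D · ⟨ ƛ (wkTy A) (wkᵗ P ·ᵗ var zero)
                                 , ƛ (wkTy B) (wkᵗ Q ·ᵗ var zero) ⟩))

    ρ⊃ : ∀ {C₁ C₂} M → Root ρ (M ·ᵗ (C₁ ⊃ C₂)) (ƛ C₁ (wk M ·ᵗ C₂))
    ρ∧ : ∀ {C₁ C₂} M → Root ρ (M ·ᵗ (C₁ ∧ C₂)) ⟨ M ·ᵗ C₁ , M ·ᵗ C₂ ⟩
    ρ∀ : ∀ {D} M → Root ρ (M ·ᵗ (∀′ D)) (Λ (wkᵗ M ·ᵗ D))

    δ⊃ : ∀ {C₁ C₂} M A P B Q →
         Root δ (M ·ᵗ (C₁ ⊃ C₂) · ⟨ ƛ A (ƛ C₁ P) , ƛ B (ƛ C₁ Q) ⟩)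
                (ƛ C₁ (wk M ·ᵗ C₂ · ⟨ ƛ A (swap P) , ƛ B (swap Q) ⟩))
    δ∧ : ∀ {C₁ C₂} M A P₁ P₂ B Q₁ Q₂ →
         Root δ (M ·ᵗ (C₁ ∧ C₂) · ⟨ ƛ A ⟨ P₁ , P₂ ⟩ , ƛ B ⟨ Q₁ , Q₂ ⟩ ⟩)
                ⟨ M ·ᵗ C₁ · ⟨ ƛ A P₁ , ƛ B Q₁ ⟩ , M ·ᵗ C₂ · ⟨ ƛ A P₂ , ƛ B Q₂ ⟩ ⟩
    δ∀ : ∀ {D} M A P B Q →
         Root δ (M ·ᵗ (∀′ D) · ⟨ ƛ A (Λ P) , ƛ B (Λ Q) ⟩)
                (Λ (wkᵗ M ·ᵗ D · ⟨ ƛ (wkTy A) P , ƛ (wkTy B) Q ⟩))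

    ε⊃ : ∀ {C₁ C₂} M A P B Q {N} →
         Root ε (M ·ᵗ (C₁ ⊃ C₂) · ⟨ ƛ A P , ƛ B Q ⟩ · N)
                (M ·ᵗ C₂ · ⟨ ƛ A (P · wk N) , ƛ B (Q · wk N) ⟩)
    ε∧ : ∀ {C₁ C₂} M A P B Q i →
         Root ε (M ·ᵗ (C₁ ∧ C₂) · ⟨ ƛ A P , ƛ B Q ⟩ ·ᵖ i)
                (M ·ᵗ pick i C₁ C₂ · ⟨ ƛ A (P ·ᵖ i) , ƛ B (Q ·ᵖ i) ⟩)
    ε∀ : ∀ {C′} M A P B Q C″ →
         Root ε (M ·ᵗ (∀′ C′) · ⟨ ƛ A P , ƛ B Q ⟩ ·ᵗ C″)
                (M ·ᵗ (C′ [ C″ ]Ty) · ⟨ ƛ A (P ·ᵗ C″) , ƛ B (Q ·ᵗ C″) ⟩)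

    ϵ⊃ : ∀ {C₁ C₂} M {N} → Root ϵ (M ·ᵗ (C₁ ⊃ C₂) · N) (M ·ᵗ C₂)
    ϵ∧ : ∀ {C₁ C₂} M i → Root ϵ (M ·ᵗ (C₁ ∧ C₂) ·ᵖ i) (M ·ᵗ pick i C₁ C₂)
    ϵ∀ : ∀ {C′} M C″ → Root ϵ (M ·ᵗ (∀′ C′) ·ᵗ C″) (M ·ᵗ (C′ [ C″ ]Ty))

  data Step (R : Pred Rule 0ℓ) {k n} : Tm k n → Tm k n → Set where
    root   : ∀ {r M M′} → r ∈ R → Root r M M′ → Step R M M′
    ξƛ     : ∀ {A M M′} → Step R M M′ → Step R (ƛ A M) (ƛ A M′)
    ξ·ˡ    : ∀ {M M′ N} → Step R M M′ → Step R (M · N) (M′ · N)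
    ξ·ʳ    : ∀ {M M′ N} → Step R M M′ → Step R (N · M) (N · M′)
    ξ⟨,⟩ˡ  : ∀ {M M′ N} → Step R M M′ → Step R ⟨ M , N ⟩ ⟨ M′ , N ⟩
    ξ⟨,⟩ʳ  : ∀ {M M′ N} → Step R M M′ → Step R ⟨ N , M ⟩ ⟨ N , M′ ⟩
    ξ·ᵖ    : ∀ {M M′ i} → Step R M M′ → Step R (M ·ᵖ i) (M′ ·ᵖ i)
    ξΛ     : ∀ {M M′} → Step R M M′ → Step R (Λ M) (Λ M′)
    ξ·ᵗ    : ∀ {M M′ B} → Step R M M′ → Step R (M ·ᵗ B) (M′ ·ᵗ B)

  _⟶[_]_ : Tm k n → Pred Rule 0ℓ → Tm k n → Set
  M ⟶[ R ] M′ = Step R M M′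

  _⟶⁺[_]_ : Tm k n → Pred Rule 0ℓ → Tm k n → Set
  M ⟶⁺[ R ] M′ = TransClosure (_⟶[ R ]_) M M′

  FineRoot : ∀ {r} {M M′ : Tm k n} → Env k n → Root r M M′ → Set
  FineRoot Γ β⊃                     = ⊤
  FineRoot Γ (β∧ _)                 = ⊤
  FineRoot Γ β∀                     = ⊤
  FineRoot Γ η⊃                     = ⊤
  FineRoot Γ η∧                     = ⊤
  FineRoot Γ η∀                     = ⊤
  FineRoot Γ (ϱ⊃ M A _ B _)         = Γ ⊢ M ∶ A ∨̲ B
  FineRoot Γ (ϱ∧ M A _ B _)         = Γ ⊢ M ∶ A ∨̲ B
  FineRoot Γ (ϱ∀ M A _ B _)         = Γ ⊢ M ∶ A ∨̲ B
  FineRoot Γ (ρ⊃ M)                 = Γ ⊢ M ∶ ⊥̲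
  FineRoot Γ (ρ∧ M)                 = Γ ⊢ M ∶ ⊥̲
  FineRoot Γ (ρ∀ M)                 = Γ ⊢ M ∶ ⊥̲
  FineRoot Γ (δ⊃ M A _ B _)         = Γ ⊢ M ∶ A ∨̲ B
  FineRoot Γ (δ∧ M A _ _ B _ _)     = Γ ⊢ M ∶ A ∨̲ B
  FineRoot Γ (δ∀ M A _ B _)         = Γ ⊢ M ∶ A ∨̲ B
  FineRoot Γ (ε⊃ M A _ B _)         = Γ ⊢ M ∶ A ∨̲ B
  FineRoot Γ (ε∧ M A _ B _ _)       = Γ ⊢ M ∶ A ∨̲ B
  FineRoot Γ (ε∀ M A _ B _ _)       = Γ ⊢ M ∶ A ∨̲ B
  FineRoot Γ (ϵ⊃ M)                 = Γ ⊢ M ∶ ⊥̲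
  FineRoot Γ (ϵ∧ M _)               = Γ ⊢ M ∶ ⊥̲
  FineRoot Γ (ϵ∀ M _)               = Γ ⊢ M ∶ ⊥̲

  -- In ξΛ the bound type variable is taken fresh for Γ, hence the weakened
  -- environment.
  data FineStep (R : Pred Rule 0ℓ) {k n} (Γ : Env k n) : Tm k n → Tm k n → Set where
    root   : ∀ {r M M′} → r ∈ R → (s : Root r M M′) → FineRoot Γ s → FineStep R Γ M M′
    ξƛ     : ∀ {A M M′} → FineStep R (A ∷ Γ) M M′ → FineStep R Γ (ƛ A M) (ƛ A M′)
    ξ·ˡ    : ∀ {M M′ N} → FineStep R Γ M M′ → FineStep R Γ (M · N) (M′ · N)
    ξ·ʳ    : ∀ {M M′ N} → FineStep R Γ M M′ → FineStep R Γ (N · M) (N · M′)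
    ξ⟨,⟩ˡ  : ∀ {M M′ N} → FineStep R Γ M M′ → FineStep R Γ ⟨ M , N ⟩ ⟨ M′ , N ⟩
    ξ⟨,⟩ʳ  : ∀ {M M′ N} → FineStep R Γ M M′ → FineStep R Γ ⟨ N , M ⟩ ⟨ N , M′ ⟩
    ξ·ᵖ    : ∀ {M M′ i} → FineStep R Γ M M′ → FineStep R Γ (M ·ᵖ i) (M′ ·ᵖ i)
    ξΛ     : ∀ {M M′} → FineStep R (map wkTy Γ) M M′ → FineStep R Γ (Λ M) (Λ M′)
    ξ·ᵗ    : ∀ {M M′ B} → FineStep R Γ M M′ → FineStep R Γ (M ·ᵗ B) (M′ ·ᵗ B)

  _⊢_⟶[_]_ : Env k n → Tm k n → Pred Rule 0ℓ → Tm k n → Set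
  Γ ⊢ M ⟶[ R ] M′ = FineStep R Γ M M′

  _⊢_⟶⁺[_]_ : Env k n → Tm k n → Pred Rule 0ℓ → Tm k n → Set
  Γ ⊢ M ⟶⁺[ R ] M′ = TransClosure (Γ ⊢_⟶[ R ]_) M M′

infix 10 _•ᵗ _• _•ᵉ

_•ᵗ : IPC.Ty k → F.Ty k
(IPC.var X) •ᵗ = F.var X
IPC.⊥ •ᵗ       = F.⊥̲
(A IPC.⊃ B) •ᵗ = A •ᵗ F.⊃ B •ᵗ
(A IPC.∧ B) •ᵗ = A •ᵗ F.∧ B •ᵗ
(A IPC.∨ B) •ᵗ = A •ᵗ F.∨̲ B •ᵗ

_• : IPC.Tm k n → F.Tm k n
(IPC.var x) •            = F.var x
(IPC.ƛ A M) •            = F.ƛ (A •ᵗ) (M •)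
(M IPC.· N) •            = M • F.· N •
IPC.⟨ M , N ⟩ •          = F.⟨ M • , N • ⟩
(M IPC.·ᵖ i) •           = M • F.·ᵖ i
(IPC.in′ i M A B) •      =
  F.Λ (F.ƛ ((F.wkTy (A •ᵗ) F.⊃ F.var zero) F.∧ (F.wkTy (B •ᵗ) F.⊃ F.var zero))
           ((F.var zero F.·ᵖ i) F.· F.wk (F.wkᵗ (M •))))
(IPC.case M A P B Q C) • =
  M • F.·ᵗ C •ᵗ F.· F.⟨ F.ƛ (A •ᵗ) (P •) , F.ƛ (B •ᵗ) (Q •) ⟩
(IPC.abort M A) •        = M • F.·ᵗ A •ᵗ

_•ᵉ : IPC.Env k n → F.Env k n
Γ •ᵉ = map _•ᵗ Γ

-- The translated reduction exists for raw terms, and is fine in Γ •ᵉ for every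
-- environment Γ in which the source is typable.

Simulated Simulated⁺ : Pred F.Rule 0ℓ → IPC.Tm k n → IPC.Tm k n → Set
Simulated R M₁ M₂ =
  M₁ • F.⟶[ R ] M₂ •
  × (∀ Γ → IPC.Typable Γ M₁ → Γ •ᵉ F.⊢ M₁ • ⟶[ R ] M₂ •)
Simulated⁺ R M₁ M₂ =
  M₁ • F.⟶⁺[ R ] M₂ •
  × (∀ Γ → IPC.Typable Γ M₁ → Γ •ᵉ F.⊢ M₁ • ⟶⁺[ R ] M₂ •)

{-# OPTIONS --safe #-}
module Submission where

-- Every root reduction of IPC translates into a few root steps of F: β∨ unfolds
-- the Church encoding of an injection, η∨ becomes δ∀, δ⊃ and then η steps, and π
-- and ϖ become one ε or ϵ step, or two (∀, then ⊃) when a disjunction is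
-- eliminated.  The translation of an injection places its argument under a Λ and
-- a λ, so passing to contexts requires fine reductions to be stable under
-- renaming.  The second simulation follows from the first, because ε, ϵ and δ
-- are derivable: ϱ or ρ pushes the elimination through, and β removes the
-- redexes created.

open import Defs
open import Data.Nat using (ℕ; suc)
open import Data.Product using (_×_; _,_)
open import Relation.Unary using (_∈_; _∪_; ｛_｝; Pred; _⊆_)
open import Data.Empty using (⊥)
open import Data.Fin using (Fin; zero; suc; lift)
open import Data.Sum using (inj₁; inj₂)
open import Data.Unit using (⊤; tt)
open import Data.Vec using (_∷_; lookup; map)
open import Data.Vec.Properties using (lookup-map)
import Data.Vec.Functional as Sub
open import Function using (_∘_; id; case_of_)
open import Level using (0ℓ)
open import Relation.Binary.Construct.Closure.Transitive using (TransClosure; [_]; _∷_; _++_)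
open import Relation.Binary.Core using (Rel; _=[_]⇒_)
open import Relation.Binary.PropositionalEquality
  using (_≡_; refl; sym; trans; cong; cong₂; subst; subst₂)

open F hiding (_[_]; _⟶[_]_; _⟶⁺[_]_)

private
  variable
    k l m n m′ n′ : ℕ

-- Renamings and substitutions of system F

lift-comm : {ξ₂ : Fin l → Fin n} {ξ₁ : Fin k → Fin l} {ζ₂ : Fin m → Fin n} {ζ₁ : Fin k → Fin m} →
            (∀ x → ξ₂ (ξ₁ x) ≡ ζ₂ (ζ₁ x)) →
            ∀ x → lift 1 ξ₂ (lift 1 ξ₁ x) ≡ lift 1 ζ₂ (lift 1 ζ₁ x)
lift-comm e zero    = refl
lift-comm e (suc x) = cong suc (e x)

-- A commuting square, rather than a fusion law, covers both composition and exchange of renamings,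
-- and a pointwise hypothesis passes under binders by `lift-comm`. The later lemmas on terms have
-- the same shape.
renTy-comm : {ξ₂ : Fin l → Fin n} {ξ₁ : Fin k → Fin l} {ζ₂ : Fin m → Fin n} {ζ₁ : Fin k → Fin m} →
             (∀ x → ξ₂ (ξ₁ x) ≡ ζ₂ (ζ₁ x)) →
             ∀ A → renTy ξ₂ (renTy ξ₁ A) ≡ renTy ζ₂ (renTy ζ₁ A)
renTy-comm e (var X) = cong var (e X)
renTy-comm e (A ⊃ B) = cong₂ _⊃_ (renTy-comm e A) (renTy-comm e B)
renTy-comm e (A ∧ B) = cong₂ _∧_ (renTy-comm e A) (renTy-comm e B)
renTy-comm e (∀′ A)  = cong ∀′_ (renTy-comm (lift-comm e) A)

renTy-wkTy : (ζ : Fin k → Fin l) → ∀ A → renTy (lift 1 ζ) (wkTy A) ≡ wkTy (renTy ζ A)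
renTy-wkTy ζ = renTy-comm (λ _ → refl)

renTy-∨̲ : (ζ : Fin k → Fin l) → ∀ A B → renTy ζ (A ∨̲ B) ≡ renTy ζ A ∨̲ renTy ζ B
renTy-∨̲ ζ A B =
  cong₂ (λ A B → ∀′ ((A ⊃ var zero) ∧ (B ⊃ var zero)) ⊃ var zero) (renTy-wkTy ζ A) (renTy-wkTy ζ B)

renTy-extsTy : {ζ : Fin l → Fin n} {σ : Fin k → Ty l} {τ : Fin m → Ty n} {ξ : Fin k → Fin m} →
               (∀ x → renTy ζ (σ x) ≡ τ (ξ x)) →
               ∀ x → renTy (lift 1 ζ) (extsTy σ x) ≡ extsTy τ (lift 1 ξ x)
renTy-extsTy         e zero    = refl
renTy-extsTy {σ = σ} e (suc x) = trans (renTy-wkTy _ (σ x)) (cong wkTy (e x))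

-- The renaming `ξ` on the right lets the source of the substitution change as well. This is what
-- instantiation needs: there `τ` is `renTy ζ B Sub.∷ var` and `ξ` is `lift 1 ζ`.
renTy-subTy : {ζ : Fin l → Fin n} {σ : Fin k → Ty l} {τ : Fin m → Ty n} {ξ : Fin k → Fin m} →
              (∀ x → renTy ζ (σ x) ≡ τ (ξ x)) →
              ∀ A → renTy ζ (subTy σ A) ≡ subTy τ (renTy ξ A)
renTy-subTy e (var X) = e X
renTy-subTy e (A ⊃ B) = cong₂ _⊃_ (renTy-subTy e A) (renTy-subTy e B)
renTy-subTy e (A ∧ B) = cong₂ _∧_ (renTy-subTy e A) (renTy-subTy e B)
renTy-subTy e (∀′ A)  = cong ∀′_ (renTy-subTy (renTy-extsTy e) A)

renTy-∷ : (ζ : Fin k → Fin l) (B : Ty k) →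
          ∀ x → renTy ζ ((B Sub.∷ var) x) ≡ (renTy ζ B Sub.∷ var) (lift 1 ζ x)
renTy-∷ ζ B zero    = refl
renTy-∷ ζ B (suc x) = refl

renTy-[]Ty : (ζ : Fin k → Fin l) → ∀ A B →
             renTy ζ (A [ B ]Ty) ≡ renTy (lift 1 ζ) A [ renTy ζ B ]Ty
renTy-[]Ty ζ A B = renTy-subTy (renTy-∷ ζ B) A

extsTy-cancel : {τ : Fin l → Ty k} {ζ : Fin k → Fin l} → (∀ x → τ (ζ x) ≡ var x) →
                ∀ x → extsTy τ (lift 1 ζ x) ≡ var x
extsTy-cancel e zero    = refl
extsTy-cancel e (suc x) = cong wkTy (e x)

subTy-cancel : {τ : Fin l → Ty k} {ζ : Fin k → Fin l} → (∀ x → τ (ζ x) ≡ var x) →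
               ∀ A → subTy τ (renTy ζ A) ≡ A
subTy-cancel e (var X) = e X
subTy-cancel e (A ⊃ B) = cong₂ _⊃_ (subTy-cancel e A) (subTy-cancel e B)
subTy-cancel e (A ∧ B) = cong₂ _∧_ (subTy-cancel e A) (subTy-cancel e B)
subTy-cancel e (∀′ A)  = cong ∀′_ (subTy-cancel (extsTy-cancel e) A)

lift-id : {ξ : Fin n → Fin n} → (∀ x → ξ x ≡ x) → ∀ x → lift 1 ξ x ≡ x
lift-id e zero    = refl
lift-id e (suc x) = cong suc (e x)

ren-id : {ξ : Fin n → Fin n} → (∀ x → ξ x ≡ x) → (M : Tm k n) → ren ξ M ≡ M
ren-id e (var x)   = cong var (e x)
ren-id e (ƛ A M)   = cong (ƛ A) (ren-id (lift-id e) M)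
ren-id e (M · N)   = cong₂ _·_ (ren-id e M) (ren-id e N)
ren-id e ⟨ M , N ⟩ = cong₂ ⟨_,_⟩ (ren-id e M) (ren-id e N)
ren-id e (M ·ᵖ i)  = cong (_·ᵖ i) (ren-id e M)
ren-id e (Λ M)     = cong Λ (ren-id e M)
ren-id e (M ·ᵗ B)  = cong (_·ᵗ B) (ren-id e M)

ren-comm : {ξ₂ : Fin l → Fin m′} {ξ₁ : Fin n → Fin l} {ζ₂ : Fin m → Fin m′} {ζ₁ : Fin n → Fin m} →
           (∀ x → ξ₂ (ξ₁ x) ≡ ζ₂ (ζ₁ x)) →
           (M : Tm k n) → ren ξ₂ (ren ξ₁ M) ≡ ren ζ₂ (ren ζ₁ M)
ren-comm e (var x)   = cong var (e x)
ren-comm e (ƛ A M)   = cong (ƛ A) (ren-comm (lift-comm e) M)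
ren-comm e (M · N)   = cong₂ _·_ (ren-comm e M) (ren-comm e N)
ren-comm e ⟨ M , N ⟩ = cong₂ ⟨_,_⟩ (ren-comm e M) (ren-comm e N)
ren-comm e (M ·ᵖ i)  = cong (_·ᵖ i) (ren-comm e M)
ren-comm e (Λ M)     = cong Λ (ren-comm e M)
ren-comm e (M ·ᵗ B)  = cong (_·ᵗ B) (ren-comm e M)

renᵗ-comm : {ξ₂ : Fin l → Fin n′} {ξ₁ : Fin k → Fin l} {ζ₂ : Fin m → Fin n′} {ζ₁ : Fin k → Fin m} →
            (∀ x → ξ₂ (ξ₁ x) ≡ ζ₂ (ζ₁ x)) →
            (M : Tm k n) → renᵗ ξ₂ (renᵗ ξ₁ M) ≡ renᵗ ζ₂ (renᵗ ζ₁ M)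
renᵗ-comm e (var x)   = refl
renᵗ-comm e (ƛ A M)   = cong₂ ƛ (renTy-comm e A) (renᵗ-comm e M)
renᵗ-comm e (M · N)   = cong₂ _·_ (renᵗ-comm e M) (renᵗ-comm e N)
renᵗ-comm e ⟨ M , N ⟩ = cong₂ ⟨_,_⟩ (renᵗ-comm e M) (renᵗ-comm e N)
renᵗ-comm e (M ·ᵖ i)  = cong (_·ᵖ i) (renᵗ-comm e M)
renᵗ-comm e (Λ M)     = cong Λ (renᵗ-comm (lift-comm e) M)
renᵗ-comm e (M ·ᵗ B)  = cong₂ _·ᵗ_ (renᵗ-comm e M) (renTy-comm e B)

ren-renᵗ : (ξ : Fin n → Fin m) (ζ : Fin k → Fin l) →
           (M : Tm k n) → ren ξ (renᵗ ζ M) ≡ renᵗ ζ (ren ξ M)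
ren-renᵗ ξ ζ (var x)   = refl
ren-renᵗ ξ ζ (ƛ A M)   = cong (ƛ _) (ren-renᵗ (lift 1 ξ) ζ M)
ren-renᵗ ξ ζ (M · N)   = cong₂ _·_ (ren-renᵗ ξ ζ M) (ren-renᵗ ξ ζ N)
ren-renᵗ ξ ζ ⟨ M , N ⟩ = cong₂ ⟨_,_⟩ (ren-renᵗ ξ ζ M) (ren-renᵗ ξ ζ N)
ren-renᵗ ξ ζ (M ·ᵖ i)  = cong (_·ᵖ i) (ren-renᵗ ξ ζ M)
ren-renᵗ ξ ζ (Λ M)     = cong Λ (ren-renᵗ ξ (lift 1 ζ) M)
ren-renᵗ ξ ζ (M ·ᵗ B)  = cong (_·ᵗ _) (ren-renᵗ ξ ζ M)

ren-exts : {ζ : Fin m → Fin m′} {σ : Fin n → Tm k m} {τ : Fin l → Tm k m′} {ξ : Fin n → Fin l} →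
           (∀ x → ren ζ (σ x) ≡ τ (ξ x)) →
           ∀ x → ren (lift 1 ζ) (exts σ x) ≡ exts τ (lift 1 ξ x)
ren-exts         e zero    = refl
ren-exts {σ = σ} e (suc x) = trans (ren-comm (λ _ → refl) (σ x)) (cong wk (e x))

-- Used in two ways: with a lifted renaming for `ξ` it moves a renaming past an instantiation, and
-- with `suc` for both `ζ` and `ξ` it moves a substitution past weakening.
ren-sub : {ζ : Fin m → Fin m′} {σ : Fin n → Tm k m} {τ : Fin l → Tm k m′} {ξ : Fin n → Fin l} →
          (∀ x → ren ζ (σ x) ≡ τ (ξ x)) →
          (M : Tm k n) → ren ζ (sub σ M) ≡ sub τ (ren ξ M)
ren-sub e (var x)   = e x
ren-sub e (ƛ A M)   = cong (ƛ A) (ren-sub (ren-exts e) M)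
ren-sub e (M · N)   = cong₂ _·_ (ren-sub e M) (ren-sub e N)
ren-sub e ⟨ M , N ⟩ = cong₂ ⟨_,_⟩ (ren-sub e M) (ren-sub e N)
ren-sub e (M ·ᵖ i)  = cong (_·ᵖ i) (ren-sub e M)
ren-sub {σ = σ} e (Λ M) =
  cong Λ (ren-sub (λ x → trans (ren-renᵗ _ _ (σ x)) (cong wkᵗ (e x))) M)
ren-sub e (M ·ᵗ B)  = cong (_·ᵗ B) (ren-sub e M)

renᵗ-exts : {ζ : Fin k → Fin l} {σ : Fin n → Tm k m} {τ : Fin n → Tm l m} →
            (∀ x → renᵗ ζ (σ x) ≡ τ x) →
            ∀ x → renᵗ ζ (exts σ x) ≡ exts τ x
renᵗ-exts         e zero    = refl
renᵗ-exts {σ = σ} e (suc x) = trans (sym (ren-renᵗ _ _ (σ x))) (cong wk (e x))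

renᵗ-sub : {ζ : Fin k → Fin l} {σ : Fin n → Tm k m} {τ : Fin n → Tm l m} →
           (∀ x → renᵗ ζ (σ x) ≡ τ x) →
           (M : Tm k n) → renᵗ ζ (sub σ M) ≡ sub τ (renᵗ ζ M)
renᵗ-sub e (var x)   = e x
renᵗ-sub e (ƛ A M)   = cong (ƛ _) (renᵗ-sub (renᵗ-exts e) M)
renᵗ-sub e (M · N)   = cong₂ _·_ (renᵗ-sub e M) (renᵗ-sub e N)
renᵗ-sub e ⟨ M , N ⟩ = cong₂ ⟨_,_⟩ (renᵗ-sub e M) (renᵗ-sub e N)
renᵗ-sub e (M ·ᵖ i)  = cong (_·ᵖ i) (renᵗ-sub e M)
renᵗ-sub {σ = σ} e (Λ M) =
  cong Λ (renᵗ-sub (λ x → trans (renᵗ-comm (λ _ → refl) (σ x)) (cong wkᵗ (e x))) M)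
renᵗ-sub e (M ·ᵗ B)  = cong (_·ᵗ _) (renᵗ-sub e M)

ren-subᵗ : (ξ : Fin n → Fin m) (τ : Fin k → Ty l) →
           (M : Tm k n) → ren ξ (subᵗ τ M) ≡ subᵗ τ (ren ξ M)
ren-subᵗ ξ τ (var x)   = refl
ren-subᵗ ξ τ (ƛ A M)   = cong (ƛ _) (ren-subᵗ (lift 1 ξ) τ M)
ren-subᵗ ξ τ (M · N)   = cong₂ _·_ (ren-subᵗ ξ τ M) (ren-subᵗ ξ τ N)
ren-subᵗ ξ τ ⟨ M , N ⟩ = cong₂ ⟨_,_⟩ (ren-subᵗ ξ τ M) (ren-subᵗ ξ τ N)
ren-subᵗ ξ τ (M ·ᵖ i)  = cong (_·ᵖ i) (ren-subᵗ ξ τ M)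
ren-subᵗ ξ τ (Λ M)     = cong Λ (ren-subᵗ ξ (extsTy τ) M)
ren-subᵗ ξ τ (M ·ᵗ B)  = cong (_·ᵗ _) (ren-subᵗ ξ τ M)

renᵗ-subᵗ : {ζ : Fin l → Fin n′} {σ : Fin k → Ty l} {τ : Fin m → Ty n′} {ξ : Fin k → Fin m} →
            (∀ x → renTy ζ (σ x) ≡ τ (ξ x)) →
            (M : Tm k n) → renᵗ ζ (subᵗ σ M) ≡ subᵗ τ (renᵗ ξ M)
renᵗ-subᵗ e (var x)   = refl
renᵗ-subᵗ e (ƛ A M)   = cong₂ ƛ (renTy-subTy e A) (renᵗ-subᵗ e M)
renᵗ-subᵗ e (M · N)   = cong₂ _·_ (renᵗ-subᵗ e M) (renᵗ-subᵗ e N)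
renᵗ-subᵗ e ⟨ M , N ⟩ = cong₂ ⟨_,_⟩ (renᵗ-subᵗ e M) (renᵗ-subᵗ e N)
renᵗ-subᵗ e (M ·ᵖ i)  = cong (_·ᵖ i) (renᵗ-subᵗ e M)
renᵗ-subᵗ e (Λ M)     = cong Λ (renᵗ-subᵗ (renTy-extsTy e) M)
renᵗ-subᵗ e (M ·ᵗ B)  = cong₂ _·ᵗ_ (renᵗ-subᵗ e M) (renTy-subTy e B)

exts-ren : {τ : Fin m → Tm k l} {ξ : Fin n → Fin m} {ζ : Fin n → Fin l} →
           (∀ x → τ (ξ x) ≡ var (ζ x)) →
           ∀ x → exts τ (lift 1 ξ x) ≡ var (lift 1 ζ x)
exts-ren e zero    = refl
exts-ren e (suc x) = cong wk (e x)

-- The composite may be any renaming `ζ`, not only the identity: contracting a β-redex whose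
-- argument is a variable amounts to a renaming, and `β-swap` obtains the exchange in this way.
sub-ren : {τ : Fin m → Tm k l} {ξ : Fin n → Fin m} {ζ : Fin n → Fin l} →
          (∀ x → τ (ξ x) ≡ var (ζ x)) →
          (M : Tm k n) → sub τ (ren ξ M) ≡ ren ζ M
sub-ren e (var x)   = e x
sub-ren e (ƛ A M)   = cong (ƛ A) (sub-ren (exts-ren e) M)
sub-ren e (M · N)   = cong₂ _·_ (sub-ren e M) (sub-ren e N)
sub-ren e ⟨ M , N ⟩ = cong₂ ⟨_,_⟩ (sub-ren e M) (sub-ren e N)
sub-ren e (M ·ᵖ i)  = cong (_·ᵖ i) (sub-ren e M)
sub-ren e (Λ M)     = cong Λ (sub-ren (cong wkᵗ ∘ e) M)
sub-ren e (M ·ᵗ B)  = cong (_·ᵗ B) (sub-ren e M)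

sub-cancel : {τ : Fin m → Tm k n} {ξ : Fin n → Fin m} → (∀ x → τ (ξ x) ≡ var x) →
             (M : Tm k n) → sub τ (ren ξ M) ≡ M
sub-cancel e M = trans (sub-ren e M) (ren-id (λ _ → refl) M)

wk-cancel : (N M : Tm k n) → sub (N Sub.∷ var) (wk M) ≡ M
wk-cancel N = sub-cancel (λ _ → refl)

wk₁-cancel : (N : Tm k n) (M : Tm k (suc n)) → sub (exts (N Sub.∷ var)) (wk₁ M) ≡ M
wk₁-cancel N = sub-cancel λ { zero → refl ; (suc x) → refl }

subᵗ-cancel : {τ : Fin l → Ty k} {ζ : Fin k → Fin l} → (∀ x → τ (ζ x) ≡ var x) →
              (M : Tm k n) → subᵗ τ (renᵗ ζ M) ≡ M
subᵗ-cancel e (var x)   = refl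
subᵗ-cancel e (ƛ A M)   = cong₂ ƛ (subTy-cancel e A) (subᵗ-cancel e M)
subᵗ-cancel e (M · N)   = cong₂ _·_ (subᵗ-cancel e M) (subᵗ-cancel e N)
subᵗ-cancel e ⟨ M , N ⟩ = cong₂ ⟨_,_⟩ (subᵗ-cancel e M) (subᵗ-cancel e N)
subᵗ-cancel e (M ·ᵖ i)  = cong (_·ᵖ i) (subᵗ-cancel e M)
subᵗ-cancel e (Λ M)     = cong Λ (subᵗ-cancel (extsTy-cancel e) M)
subᵗ-cancel e (M ·ᵗ B)  = cong₂ _·ᵗ_ (subᵗ-cancel e M) (subTy-cancel e B)

-- Simultaneous renaming of type and term variables

-- Both sorts are renamed at once because the encoding of an injection puts its argument under a
-- type binder and a term binder. A single stability result then covers this passage.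
rename : (Fin k → Fin l) → (Fin n → Fin m) → Tm k n → Tm l m
rename ζ ξ M = renᵗ ζ (ren ξ M)

module _ (ζ : Fin k → Fin l) where

  -- All renamings of term variables that occur in contracta (`wk`, `wk₁`, `swap`) are instances,
  -- each reduced to a check on variables.
  rename-ren : {ξ : Fin m → Fin m′} {χ : Fin n → Fin m} {χ′ : Fin n′ → Fin m′} {ξ′ : Fin n → Fin n′} →
               (∀ x → ξ (χ x) ≡ χ′ (ξ′ x)) →
               (M : Tm k n) → rename ζ ξ (ren χ M) ≡ ren χ′ (rename ζ ξ′ M)
  rename-ren e M = trans (cong (renᵗ ζ) (ren-comm e M)) (sym (ren-renᵗ _ _ (ren _ M)))

  rename-wk : (ξ : Fin n → Fin m) (M : Tm k n) → rename ζ (lift 1 ξ) (wk M) ≡ wk (rename ζ ξ M)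
  rename-wk ξ = rename-ren (λ _ → refl)

  rename-wk₁ : (ξ : Fin n → Fin m) (M : Tm k (suc n)) →
               rename ζ (lift 1 (lift 1 ξ)) (wk₁ M) ≡ wk₁ (rename ζ (lift 1 ξ) M)
  rename-wk₁ ξ = rename-ren λ { zero → refl ; (suc x) → refl }

  rename-swap : (ξ : Fin n → Fin m) (M : Tm k (suc (suc n))) →
                rename ζ (lift 1 (lift 1 ξ)) (swap M) ≡ swap (rename ζ (lift 1 (lift 1 ξ)) M)
  rename-swap ξ = rename-ren λ { zero → refl ; (suc zero) → refl ; (suc (suc x)) → refl }

  rename-wkᵗ : (ξ : Fin n → Fin m) (M : Tm k n) → rename (lift 1 ζ) ξ (wkᵗ M) ≡ wkᵗ (rename ζ ξ M)
  rename-wkᵗ ξ M =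
    trans (cong (renᵗ _) (ren-renᵗ ξ _ M)) (renᵗ-comm (λ _ → refl) (ren ξ M))

  rename-[] : (ξ : Fin n → Fin m) (M : Tm k (suc n)) (N : Tm k n) →
              rename ζ ξ (M F.[ N ]) ≡ rename ζ (lift 1 ξ) M F.[ rename ζ ξ N ]
  rename-[] ξ M N = trans
    (cong (renᵗ ζ) (ren-sub {τ = ren ξ N Sub.∷ var} (λ { zero → refl ; (suc x) → refl }) M))
    (renᵗ-sub (λ { zero → refl ; (suc x) → refl }) (ren (lift 1 ξ) M))

  rename-[]ᵗ : (ξ : Fin n → Fin m) (M : Tm (suc k) n) (B : Ty k) →
               rename ζ ξ (M [ B ]ᵗ) ≡ rename (lift 1 ζ) ξ M [ renTy ζ B ]ᵗ
  rename-[]ᵗ ξ M B = trans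
    (cong (renᵗ ζ) (ren-subᵗ ξ _ M))
    (renᵗ-subᵗ (renTy-∷ ζ B) (ren ξ M))

-- Typing under renaming

Compat : (Fin k → Fin l) → (Fin n → Fin m) → Env k n → Env l m → Set
Compat ζ ξ Γ Δ = ∀ x → lookup Δ (ξ x) ≡ renTy ζ (lookup Γ x)

module _ {ζ : Fin k → Fin l} {ξ : Fin n → Fin m} where

  Compat-∷ : ∀ {Γ Δ A} → Compat ζ ξ Γ Δ → Compat ζ (lift 1 ξ) (A ∷ Γ) (renTy ζ A ∷ Δ)
  Compat-∷ c zero    = refl
  Compat-∷ c (suc x) = c x

  Compat-wkTy : ∀ {Γ Δ} → Compat ζ ξ Γ Δ → Compat (lift 1 ζ) ξ (map wkTy Γ) (map wkTy Δ)
  Compat-wkTy {Γ} {Δ} c x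
    rewrite lookup-map (ξ x) wkTy Δ | lookup-map x wkTy Γ | c x = sym (renTy-wkTy ζ (lookup Γ x))

⊢rename : ∀ {ζ : Fin k → Fin l} {ξ : Fin n → Fin m} {Γ Δ M A} → Compat ζ ξ Γ Δ →
          Γ ⊢ M ∶ A → Δ ⊢ rename ζ ξ M ∶ renTy ζ A
⊢rename {ξ = ξ} {Δ = Δ} c (⊢var x) = subst (Δ ⊢ var (ξ x) ∶_) (c x) (⊢var (ξ x))
⊢rename c (⊢ƛ M)     = ⊢ƛ (⊢rename (Compat-∷ c) M)
⊢rename c (⊢· M N)   = ⊢· (⊢rename c M) (⊢rename c N)
⊢rename c (⊢⟨,⟩ M N) = ⊢⟨,⟩ (⊢rename c M) (⊢rename c N)
⊢rename c (⊢·ᵖ 𝟏 M)  = ⊢·ᵖ 𝟏 (⊢rename c M)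
⊢rename c (⊢·ᵖ 𝟐 M)  = ⊢·ᵖ 𝟐 (⊢rename c M)
⊢rename {Γ = Γ} {Δ} c (⊢Λ M) = ⊢Λ (⊢rename (Compat-wkTy {Γ = Γ} {Δ} c) M)
⊢rename {ζ = ζ} c (⊢·ᵗ {A} B M) =
  subst (_ ⊢ _ ∶_) (sym (renTy-[]Ty ζ A B)) (⊢·ᵗ (renTy ζ B) (⊢rename c M))

-- Fineness asks for a type that is literally of the form `A ∨̲ B`. Renaming goes under the
-- quantifier hidden in it and reaches this form only up to `renTy-∨̲`.
⊢rename-∨̲ : ∀ {ζ : Fin k → Fin l} {ξ : Fin n → Fin m} {Γ Δ M A B} → Compat ζ ξ Γ Δ →
            Γ ⊢ M ∶ A ∨̲ B → Δ ⊢ rename ζ ξ M ∶ renTy ζ A ∨̲ renTy ζ B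
⊢rename-∨̲ {ζ = ζ} {ξ} {Δ = Δ} {M} {A} {B} c d = subst (Δ ⊢ rename ζ ξ M ∶_) (renTy-∨̲ _ A B) (⊢rename c d)

-- The right-hand environment is the one at the argument of an encoded injection, below its `Λ` and
-- `ƛ`.
Compat-suc : ∀ {Γ : Env k n} {A} → Compat suc suc Γ (A ∷ map wkTy Γ)
Compat-suc {Γ = Γ} x = lookup-map x wkTy Γ

rename-suc : (M : Tm k n) → rename suc suc M ≡ wk (wkᵗ M)
rename-suc M = sym (ren-renᵗ suc suc M)

-- Provides the fineness of the second δ-step in `case-η`, which takes place under a `Λ`. The term
-- renaming is the identity here and is removed by `ren-id`.
⊢wkᵗ : ∀ {Γ : Env k n} {M A B} → Γ ⊢ M ∶ A ∨̲ B → map wkTy Γ ⊢ wkᵗ M ∶ wkTy A ∨̲ wkTy B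
⊢wkᵗ {Γ = Γ} {M} d = subst (λ N → _ ⊢ wkᵗ N ∶ _) (ren-id (λ _ → refl) M)
  (⊢rename-∨̲ {ξ = id} (λ x → lookup-map x wkTy Γ) d)

-- Steps fine in a family of environments

-- One reduction that is fine in every γ i simultaneously: I = ⊥ gives raw
-- reduction and I = ⊤ gives reduction that is fine in a single environment.
Redex : Set → Set₁
Redex I = ∀ {k n} → (I → Env k n) → Tm k n → Tm k n → Set

module _ {I : Set} where

  data FineRedex (R : Pred Rule 0ℓ) {k n} (γ : I → Env k n) : Tm k n → Tm k n → Set where
    contract : ∀ {r M M′} → r ∈ R → (s : Root r M M′) → (∀ i → FineRoot (γ i) s) →
               FineRedex R γ M M′

  -- The base is a parameter so that the closure can be taken of single contractions and also of
  -- whole reduction sequences, such as the image of one IPC redex.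
  data Closure (𝓑 : Redex I) {k n} (γ : I → Env k n) : Tm k n → Tm k n → Set where
    root  : ∀ {M M′} → 𝓑 γ M M′ → Closure 𝓑 γ M M′
    ξƛ    : ∀ {A M M′} → Closure 𝓑 (λ i → A ∷ γ i) M M′ → Closure 𝓑 γ (ƛ A M) (ƛ A M′)
    ξ·ˡ   : ∀ {M M′ N} → Closure 𝓑 γ M M′ → Closure 𝓑 γ (M · N) (M′ · N)
    ξ·ʳ   : ∀ {M M′ N} → Closure 𝓑 γ M M′ → Closure 𝓑 γ (N · M) (N · M′)
    ξ⟨,⟩ˡ : ∀ {M M′ N} → Closure 𝓑 γ M M′ → Closure 𝓑 γ ⟨ M , N ⟩ ⟨ M′ , N ⟩
    ξ⟨,⟩ʳ : ∀ {M M′ N} → Closure 𝓑 γ M M′ → Closure 𝓑 γ ⟨ N , M ⟩ ⟨ N , M′ ⟩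
    ξ·ᵖ   : ∀ {M M′ i} → Closure 𝓑 γ M M′ → Closure 𝓑 γ (M ·ᵖ i) (M′ ·ᵖ i)
    ξΛ    : ∀ {M M′} → Closure 𝓑 (λ i → map wkTy (γ i)) M M′ → Closure 𝓑 γ (Λ M) (Λ M′)
    ξ·ᵗ   : ∀ {M M′ B} → Closure 𝓑 γ M M′ → Closure 𝓑 γ (M ·ᵗ B) (M′ ·ᵗ B)

  Closure⁺ : Redex I → Redex I
  Closure⁺ 𝓑 γ = TransClosure (Closure 𝓑 γ)

gmap : ∀ {A B : Set} {R : Rel A 0ℓ} {S : Rel B 0ℓ} {f : A → B} →
       R =[ f ]⇒ S → TransClosure R =[ f ]⇒ TransClosure S
gmap g [ r ]    = [ g r ]
gmap g (r ∷ rs) = g r ∷ gmap g rs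

module _ {I : Set} {𝓑 𝓒 : Redex I}
         (𝓑⊆𝓒⁺ : ∀ {k n} {γ : I → Env k n} {M M′} → 𝓑 γ M M′ → Closure⁺ 𝓒 γ M M′) where

  -- Serves two purposes: with `id` it flattens a closure over sequences into one sequence, and with
  -- `commuting⇒atomizing` it replaces one set of rules by another inside any context.
  simulate-base : ∀ {γ : I → Env k n} {M M′} → Closure 𝓑 γ M M′ → Closure⁺ 𝓒 γ M M′
  simulate-base (root b)  = 𝓑⊆𝓒⁺ b
  simulate-base (ξƛ s)    = gmap ξƛ (simulate-base s)
  simulate-base (ξ·ˡ s)   = gmap ξ·ˡ (simulate-base s)
  simulate-base (ξ·ʳ s)   = gmap ξ·ʳ (simulate-base s)
  simulate-base (ξ⟨,⟩ˡ s) = gmap ξ⟨,⟩ˡ (simulate-base s)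
  simulate-base (ξ⟨,⟩ʳ s) = gmap ξ⟨,⟩ʳ (simulate-base s)
  simulate-base (ξ·ᵖ s)   = gmap ξ·ᵖ (simulate-base s)
  simulate-base (ξΛ s)    = gmap ξΛ (simulate-base s)
  simulate-base (ξ·ᵗ s)   = gmap ξ·ᵗ (simulate-base s)

  simulate-base⁺ : ∀ {γ : I → Env k n} {M M′} → Closure⁺ 𝓑 γ M M′ → Closure⁺ 𝓒 γ M M′
  simulate-base⁺ [ s ]    = simulate-base s
  simulate-base⁺ (s ∷ ss) = simulate-base s ++ simulate-base⁺ ss

-- Stability of fine reduction under renaming

Renamable : ∀ {I} → Redex I → Set
Renamable {I} 𝓑 =
  ∀ {k l n m} {ζ : Fin k → Fin l} {ξ : Fin n → Fin m} {γ : I → Env k n} {γ′ : I → Env l m} {M M′} →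
  (∀ i → Compat ζ ξ (γ i) (γ′ i)) → 𝓑 γ M M′ → 𝓑 γ′ (rename ζ ξ M) (rename ζ ξ M′)

module _ {I : Set} where

  -- Contracta are assembled by weakening, exchange and instantiation, all of which commute with
  -- `rename`; the rewrites bring the renamed contractum back to the form required by the same rule.
  -- The side condition survives because typing does.
  FineRedex-rename : ∀ {R} → Renamable {I} (FineRedex R)
  FineRedex-rename {ζ = ζ} {ξ} c (contract r∈R (β⊃ {M = M} {N}) f)
    rewrite rename-[] ζ ξ M N = contract r∈R β⊃ f
  -- `rename` passes through `pick i` only once `i` is known, hence the split on the index here and
  -- in the other projection rules.
  FineRedex-rename c (contract r∈R (β∧ 𝟏) f) = contract r∈R (β∧ 𝟏) f
  FineRedex-rename c (contract r∈R (β∧ 𝟐) f) = contract r∈R (β∧ 𝟐) f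
  FineRedex-rename {ζ = ζ} {ξ} c (contract r∈R (β∀ {M} {B}) f)
    rewrite rename-[]ᵗ ζ ξ M B = contract r∈R β∀ f
  FineRedex-rename {ζ = ζ} {ξ} c (contract r∈R (η⊃ {M = M}) f)
    rewrite rename-wk ζ ξ M = contract r∈R η⊃ f
  FineRedex-rename c (contract r∈R η∧ f) = contract r∈R η∧ f
  FineRedex-rename {ζ = ζ} {ξ} c (contract r∈R (η∀ {M}) f)
    rewrite rename-wkᵗ ζ ξ M = contract r∈R η∀ f
  FineRedex-rename {ζ = ζ} {ξ} c (contract r∈R (ϱ⊃ M A P B Q) f)
    rewrite rename-wk ζ ξ M | rename-wk₁ ζ ξ P | rename-wk₁ ζ ξ Q =
    contract r∈R (ϱ⊃ _ _ _ _ _) (λ i → ⊢rename-∨̲ (c i) (f i))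
  FineRedex-rename c (contract r∈R (ϱ∧ M A P B Q) f) =
    contract r∈R (ϱ∧ _ _ _ _ _) (λ i → ⊢rename-∨̲ (c i) (f i))
  FineRedex-rename {ζ = ζ} {ξ} c (contract r∈R (ϱ∀ M A P B Q) f)
    rewrite rename-wkᵗ ζ ξ M | renTy-wkTy ζ A | renTy-wkTy ζ B
          | rename-wkᵗ ζ (lift 1 ξ) P | rename-wkᵗ ζ (lift 1 ξ) Q =
    contract r∈R (ϱ∀ _ _ _ _ _) (λ i → ⊢rename-∨̲ (c i) (f i))
  FineRedex-rename {ζ = ζ} {ξ} c (contract r∈R (ρ⊃ M) f)
    rewrite rename-wk ζ ξ M = contract r∈R (ρ⊃ _) (λ i → ⊢rename (c i) (f i))
  FineRedex-rename c (contract r∈R (ρ∧ M) f) =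
    contract r∈R (ρ∧ _) (λ i → ⊢rename (c i) (f i))
  FineRedex-rename {ζ = ζ} {ξ} c (contract r∈R (ρ∀ M) f)
    rewrite rename-wkᵗ ζ ξ M = contract r∈R (ρ∀ _) (λ i → ⊢rename (c i) (f i))
  FineRedex-rename {ζ = ζ} {ξ} c (contract r∈R (δ⊃ M A P B Q) f)
    rewrite rename-wk ζ ξ M | rename-swap ζ ξ P | rename-swap ζ ξ Q =
    contract r∈R (δ⊃ _ _ _ _ _) (λ i → ⊢rename-∨̲ (c i) (f i))
  FineRedex-rename c (contract r∈R (δ∧ M A P₁ P₂ B Q₁ Q₂) f) =
    contract r∈R (δ∧ _ _ _ _ _ _ _) (λ i → ⊢rename-∨̲ (c i) (f i))
  FineRedex-rename {ζ = ζ} {ξ} c (contract r∈R (δ∀ M A P B Q) f)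
    rewrite rename-wkᵗ ζ ξ M | renTy-wkTy ζ A | renTy-wkTy ζ B =
    contract r∈R (δ∀ _ _ _ _ _) (λ i → ⊢rename-∨̲ (c i) (f i))
  FineRedex-rename {ζ = ζ} {ξ} c (contract r∈R (ε⊃ M A P B Q {N}) f)
    rewrite rename-wk ζ ξ N =
    contract r∈R (ε⊃ _ _ _ _ _) (λ i → ⊢rename-∨̲ (c i) (f i))
  FineRedex-rename c (contract r∈R (ε∧ M A P B Q 𝟏) f) =
    contract r∈R (ε∧ _ _ _ _ _ 𝟏) (λ i → ⊢rename-∨̲ (c i) (f i))
  FineRedex-rename c (contract r∈R (ε∧ M A P B Q 𝟐) f) =
    contract r∈R (ε∧ _ _ _ _ _ 𝟐) (λ i → ⊢rename-∨̲ (c i) (f i))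
  FineRedex-rename {ζ = ζ} c (contract r∈R (ε∀ {C′} M A P B Q C″) f)
    rewrite renTy-[]Ty ζ C′ C″ =
    contract r∈R (ε∀ _ _ _ _ _ _) (λ i → ⊢rename-∨̲ (c i) (f i))
  FineRedex-rename c (contract r∈R (ϵ⊃ M) f) =
    contract r∈R (ϵ⊃ _) (λ i → ⊢rename (c i) (f i))
  FineRedex-rename c (contract r∈R (ϵ∧ M 𝟏) f) =
    contract r∈R (ϵ∧ _ 𝟏) (λ i → ⊢rename (c i) (f i))
  FineRedex-rename c (contract r∈R (ϵ∧ M 𝟐) f) =
    contract r∈R (ϵ∧ _ 𝟐) (λ i → ⊢rename (c i) (f i))
  FineRedex-rename {ζ = ζ} c (contract r∈R (ϵ∀ {C′} M C″) f)
    rewrite renTy-[]Ty ζ C′ C″ = contract r∈R (ϵ∀ _ _) (λ i → ⊢rename (c i) (f i))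

  Closure-rename : ∀ {𝓑 : Redex I} → Renamable {I} 𝓑 → Renamable {I} (Closure 𝓑)
  Closure-rename b c (root s)  = root (b c s)
  Closure-rename b {γ = γ} {γ′} c (ξƛ s) =
    ξƛ (Closure-rename b (λ i → Compat-∷ {Γ = γ i} {γ′ i} (c i)) s)
  Closure-rename b c (ξ·ˡ s)   = ξ·ˡ (Closure-rename b c s)
  Closure-rename b c (ξ·ʳ s)   = ξ·ʳ (Closure-rename b c s)
  Closure-rename b c (ξ⟨,⟩ˡ s) = ξ⟨,⟩ˡ (Closure-rename b c s)
  Closure-rename b c (ξ⟨,⟩ʳ s) = ξ⟨,⟩ʳ (Closure-rename b c s)
  Closure-rename b c (ξ·ᵖ s)   = ξ·ᵖ (Closure-rename b c s)
  Closure-rename b {γ = γ} {γ′} c (ξΛ s) =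
    ξΛ (Closure-rename b (λ i → Compat-wkTy {Γ = γ i} {γ′ i} (c i)) s)
  Closure-rename b c (ξ·ᵗ s)   = ξ·ᵗ (Closure-rename b c s)

  Closure⁺-rename : ∀ {𝓑 : Redex I} → Renamable {I} 𝓑 → Renamable {I} (Closure⁺ 𝓑)
  Closure⁺-rename b c = gmap (Closure-rename b c)

  Closure-wk : ∀ {𝓑 : Redex I} → Renamable {I} 𝓑 → ∀ {γ : I → Env k n} {A M M′} → Closure 𝓑 γ M M′ →
               Closure 𝓑 (λ i → A ∷ map wkTy (γ i)) (wk (wkᵗ M)) (wk (wkᵗ M′))
  Closure-wk {𝓑 = 𝓑} b {γ} {A} {M} {M′} s =
    subst₂ (Closure 𝓑 _) (rename-suc M) (rename-suc M′)
      (Closure-rename b (λ i → Compat-suc {Γ = γ i} {A}) s)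

-- Back to raw and fine reduction

Closure⇒Step : ∀ {R} {γ : ⊥ → Env k n} {M M′} → Closure (FineRedex R) γ M M′ → Step R M M′
Closure⇒Step (root (contract r∈R s _)) = root r∈R s
Closure⇒Step (ξƛ s)    = ξƛ (Closure⇒Step s)
Closure⇒Step (ξ·ˡ s)   = ξ·ˡ (Closure⇒Step s)
Closure⇒Step (ξ·ʳ s)   = ξ·ʳ (Closure⇒Step s)
Closure⇒Step (ξ⟨,⟩ˡ s) = ξ⟨,⟩ˡ (Closure⇒Step s)
Closure⇒Step (ξ⟨,⟩ʳ s) = ξ⟨,⟩ʳ (Closure⇒Step s)
Closure⇒Step (ξ·ᵖ s)   = ξ·ᵖ (Closure⇒Step s)
Closure⇒Step (ξΛ s)    = ξΛ (Closure⇒Step s)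
Closure⇒Step (ξ·ᵗ s)   = ξ·ᵗ (Closure⇒Step s)

Closure⇒FineStep : ∀ {R} {γ : ⊤ → Env k n} {M M′} →
                   Closure (FineRedex R) γ M M′ → FineStep R (γ tt) M M′
Closure⇒FineStep (root (contract r∈R s f)) = root r∈R s (f tt)
Closure⇒FineStep (ξƛ s)    = ξƛ (Closure⇒FineStep s)
Closure⇒FineStep (ξ·ˡ s)   = ξ·ˡ (Closure⇒FineStep s)
Closure⇒FineStep (ξ·ʳ s)   = ξ·ʳ (Closure⇒FineStep s)
Closure⇒FineStep (ξ⟨,⟩ˡ s) = ξ⟨,⟩ˡ (Closure⇒FineStep s)
Closure⇒FineStep (ξ⟨,⟩ʳ s) = ξ⟨,⟩ʳ (Closure⇒FineStep s)
Closure⇒FineStep (ξ·ᵖ s)   = ξ·ᵖ (Closure⇒FineStep s)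
Closure⇒FineStep (ξΛ s)    = ξΛ (Closure⇒FineStep s)
Closure⇒FineStep (ξ·ᵗ s)   = ξ·ᵗ (Closure⇒FineStep s)

-- The translation

Alternatives : Ty k → Ty k → Ty (suc k)
Alternatives A B = (wkTy A ⊃ var zero) ∧ (wkTy B ⊃ var zero)

in̲ : Index → Tm k n → Ty k → Ty k → Tm k n
in̲ i M A B = Λ (ƛ (Alternatives A B) (var zero ·ᵖ i · wk (wkᵗ M)))

•-ren : (ξ : Fin n → Fin m) (M : IPC.Tm k n) → (IPC.ren ξ M) • ≡ ren ξ (M •)
•-ren ξ (IPC.var x)          = refl
•-ren ξ (IPC.ƛ A M)          = cong (ƛ _) (•-ren (lift 1 ξ) M)
•-ren ξ (M IPC.· N)          = cong₂ _·_ (•-ren ξ M) (•-ren ξ N)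
•-ren ξ IPC.⟨ M , N ⟩        = cong₂ ⟨_,_⟩ (•-ren ξ M) (•-ren ξ N)
•-ren ξ (M IPC.·ᵖ i)         = cong (_·ᵖ i) (•-ren ξ M)
•-ren ξ (IPC.in′ i M A B)    = cong (λ N → Λ (ƛ _ (var zero ·ᵖ i · N)))
  (trans (cong wk (trans (cong wkᵗ (•-ren ξ M)) (sym (ren-renᵗ ξ suc (M •)))))
         (ren-comm (λ _ → refl) (wkᵗ (M •))))
•-ren ξ (IPC.case M A P B Q C) =
  cong₂ (λ M N → M ·ᵗ C •ᵗ · N) (•-ren ξ M)
    (cong₂ (λ P Q → ⟨ ƛ _ P , ƛ _ Q ⟩) (•-ren (lift 1 ξ) P) (•-ren (lift 1 ξ) Q))
•-ren ξ (IPC.abort M A)      = cong (_·ᵗ _) (•-ren ξ M)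

•-exts : {σ : Fin n → IPC.Tm k m} {τ : Fin n → Tm k m} → (∀ x → (σ x) • ≡ τ x) →
         ∀ x → (IPC.exts σ x) • ≡ exts τ x
•-exts         e zero    = refl
•-exts {σ = σ} e (suc x) = trans (•-ren suc (σ x)) (cong wk (e x))

•-sub : {σ : Fin n → IPC.Tm k m} {τ : Fin n → Tm k m} → (∀ x → (σ x) • ≡ τ x) →
        (M : IPC.Tm k n) → (IPC.sub σ M) • ≡ sub τ (M •)
•-sub e (IPC.var x)          = e x
•-sub e (IPC.ƛ A M)          = cong (ƛ _) (•-sub (•-exts e) M)
•-sub e (M IPC.· N)          = cong₂ _·_ (•-sub e M) (•-sub e N)
•-sub e IPC.⟨ M , N ⟩        = cong₂ ⟨_,_⟩ (•-sub e M) (•-sub e N)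
•-sub e (M IPC.·ᵖ i)         = cong (_·ᵖ i) (•-sub e M)
-- The argument sits below `Λ` and `ƛ`, where `sub` uses `wkᵗ ∘ τ` and then `exts`; `renᵗ-sub` and
-- `ren-sub` move the two weakenings past it in that order.
•-sub e (IPC.in′ i M A B)    = cong (λ N → Λ (ƛ _ (var zero ·ᵖ i · N)))
  (trans (cong wk (trans (cong wkᵗ (•-sub e M)) (renᵗ-sub (λ _ → refl) (M •))))
         (ren-sub (λ _ → refl) (wkᵗ (M •))))
•-sub e (IPC.case M A P B Q C) =
  cong₂ (λ M N → M ·ᵗ C •ᵗ · N) (•-sub e M)
    (cong₂ (λ P Q → ⟨ ƛ _ P , ƛ _ Q ⟩) (•-sub (•-exts e) P) (•-sub (•-exts e) Q))
•-sub e (IPC.abort M A)      = cong (_·ᵗ _) (•-sub e M)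

•-[] : (M : IPC.Tm k (suc n)) (N : IPC.Tm k n) → (M IPC.[ N ]) • ≡ (M •) F.[ N • ]
•-[] M N = •-sub (λ { zero → refl ; (suc x) → refl }) M

-- The source of all fineness conditions: inverting the typing of an IPC redex gives the type of the
-- eliminated disjunction or absurdity, and its translation is the type demanded of the head term.
⊢• : ∀ {Γ : IPC.Env k n} {M A} → Γ IPC.⊢ M ∶ A → Γ •ᵉ ⊢ M • ∶ A •ᵗ
⊢• {Γ = Γ} (IPC.⊢var x) = subst (Γ •ᵉ ⊢ var x ∶_) (lookup-map x _•ᵗ Γ) (⊢var x)
⊢• (IPC.⊢ƛ M)     = ⊢ƛ (⊢• M)
⊢• (IPC.⊢· M N)   = ⊢· (⊢• M) (⊢• N)
⊢• (IPC.⊢⟨,⟩ M N) = ⊢⟨,⟩ (⊢• M) (⊢• N)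
⊢• (IPC.⊢·ᵖ 𝟏 M)  = ⊢·ᵖ 𝟏 (⊢• M)
⊢• (IPC.⊢·ᵖ 𝟐 M)  = ⊢·ᵖ 𝟐 (⊢• M)
⊢• {Γ = Γ} (IPC.⊢in {A} {B} {M} i d) =
  ⊢Λ (⊢ƛ (⊢injection i (subst (W ∷ map wkTy (Γ •ᵉ) ⊢_∶ _) (rename-suc (M •))
    (⊢rename (Compat-suc {Γ = Γ •ᵉ} {W}) (⊢• d)))))
  where
  W = Alternatives (A •ᵗ) (B •ᵗ)

  ⊢injection : ∀ {Δ N} i → W ∷ Δ ⊢ N ∶ wkTy ((pick i A B) •ᵗ) →
               W ∷ Δ ⊢ var zero ·ᵖ i · N ∶ var zero
  ⊢injection 𝟏 = ⊢· (⊢·ᵖ 𝟏 (⊢var zero))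
  ⊢injection 𝟐 = ⊢· (⊢·ᵖ 𝟐 (⊢var zero))
⊢• {Γ = Γ} (IPC.⊢case {A} {B} {C} {M} d e f) =
  -- Instantiating `A •ᵗ ∨̲ B •ᵗ` at `C •ᵗ` leaves `A •ᵗ` and `B •ᵗ` weakened and then substituted
  -- into, which cancels only propositionally.
  ⊢· (subst (Γ •ᵉ ⊢ M • ·ᵗ C •ᵗ ∶_)
       (cong₂ (λ A B → (A ⊃ C •ᵗ) ∧ (B ⊃ C •ᵗ) ⊃ C •ᵗ)
         (subTy-cancel (λ _ → refl) (A •ᵗ)) (subTy-cancel (λ _ → refl) (B •ᵗ)))
       (⊢·ᵗ (C •ᵗ) (⊢• d)))
     (⊢⟨,⟩ (⊢ƛ (⊢• e)) (⊢ƛ (⊢• f)))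
⊢• (IPC.⊢abort {A} M) = ⊢·ᵗ (A •ᵗ) (⊢• M)

-- From root steps to steps in context

module _ {I : Set} where

  Typed : (I → IPC.Env k n) → IPC.Tm k n → Set
  Typed γ M = ∀ i → IPC.Typable (γ i) M

  module _ {R : Pred IPC.Rule 0ℓ} {𝓑 : Redex I} (b : Renamable 𝓑)
           (simulate-root : ∀ {k n} {γ : I → IPC.Env k n} {r M M′} →
              r ∈ R → IPC.Root r M M′ → Typed γ M → 𝓑 (_•ᵉ ∘ γ) (M •) (M′ •)) where

    -- The translation copies each subterm exactly once, so a step in context becomes one base step
    -- in context, and typability descends by inversion. Renamability of the base is needed for
    -- `in′` alone, whose argument is weakened.
    simulate : ∀ {γ : I → IPC.Env k n} {M M′} →
               M IPC.⟶[ R ] M′ → Typed γ M → Closure 𝓑 (_•ᵉ ∘ γ) (M •) (M′ •)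
    simulate (IPC.root r∈R s) t = root (simulate-root r∈R s t)
    simulate {γ = γ} (IPC.ξƛ {A} s) t =
      ξƛ (simulate {γ = λ i → A ∷ γ i} s λ i → case t i of λ { (_ , IPC.⊢ƛ d) → _ , d })
    simulate (IPC.ξ·ˡ s) t =
      ξ·ˡ (simulate s λ i → case t i of λ { (_ , IPC.⊢· d _) → _ , d })
    simulate (IPC.ξ·ʳ s) t =
      ξ·ʳ (simulate s λ i → case t i of λ { (_ , IPC.⊢· _ d) → _ , d })
    simulate (IPC.ξ⟨,⟩ˡ s) t =
      ξ⟨,⟩ˡ (simulate s λ i → case t i of λ { (_ , IPC.⊢⟨,⟩ d _) → _ , d })
    simulate (IPC.ξ⟨,⟩ʳ s) t =
      ξ⟨,⟩ʳ (simulate s λ i → case t i of λ { (_ , IPC.⊢⟨,⟩ _ d) → _ , d })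
    simulate (IPC.ξ·ᵖ s) t =
      ξ·ᵖ (simulate s λ i → case t i of λ { (_ , IPC.⊢·ᵖ _ d) → _ , d })
    simulate (IPC.ξin′ s) t =
      ξΛ (ξƛ (ξ·ʳ (Closure-wk b
        (simulate s λ i → case t i of λ { (_ , IPC.⊢in _ d) → _ , d }))))
    simulate (IPC.ξcase₀ s) t =
      ξ·ˡ (ξ·ᵗ (simulate s λ i → case t i of λ { (_ , IPC.⊢case d _ _) → _ , d }))
    simulate {γ = γ} (IPC.ξcase₁ {A = A} s) t =
      ξ·ʳ (ξ⟨,⟩ˡ (ξƛ (simulate {γ = λ i → A ∷ γ i} s
        λ i → case t i of λ { (_ , IPC.⊢case _ d _) → _ , d })))
    simulate {γ = γ} (IPC.ξcase₂ {B = B} s) t =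
      ξ·ʳ (ξ⟨,⟩ʳ (ξƛ (simulate {γ = λ i → B ∷ γ i} s
        λ i → case t i of λ { (_ , IPC.⊢case _ _ d) → _ , d })))
    simulate (IPC.ξabort s) t =
      ξ·ᵗ (simulate s λ i → case t i of λ { (_ , IPC.⊢abort d) → _ , d })

-- The hypothesis is uniform in the index set. The empty family makes typability vacuous and gives
-- the raw reduction; the one-element family gives the fine one.
simulated : ∀ {R R′} →
  (∀ {I : Set} {k n} {γ : I → IPC.Env k n} {r M M′} →
     r ∈ R → IPC.Root r M M′ → Typed γ M → FineRedex R′ (_•ᵉ ∘ γ) (M •) (M′ •)) →
  ∀ {M M′ : IPC.Tm k n} → M IPC.⟶[ R ] M′ → Simulated R′ M M′
simulated h s =
  Closure⇒Step (simulate FineRedex-rename h {γ = λ ()} s λ ()) ,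
  λ Γ t → Closure⇒FineStep (simulate FineRedex-rename h {γ = λ _ → Γ} s λ _ → t)

simulated⁺ : ∀ {R R′} →
  (∀ {I : Set} {k n} {γ : I → IPC.Env k n} {r M M′} →
     r ∈ R → IPC.Root r M M′ → Typed γ M → Closure⁺ (FineRedex R′) (_•ᵉ ∘ γ) (M •) (M′ •)) →
  ∀ {M M′ : IPC.Tm k n} → M IPC.⟶[ R ] M′ → Simulated⁺ R′ M M′
simulated⁺ {R = R} {R′} h s =
  gmap Closure⇒Step (steps {γ = λ ()} s λ ()) ,
  λ Γ t → gmap Closure⇒FineStep (steps {γ = λ _ → Γ} s λ _ → t)
  where
  steps : ∀ {I : Set} {k n} {γ : I → IPC.Env k n} {M M′} →
          M IPC.⟶[ R ] M′ → Typed γ M → Closure⁺ (FineRedex R′) (_•ᵉ ∘ γ) (M •) (M′ •)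
  -- Here the base relation is itself a reduction sequence, so that the image of the context
  -- surrounds a whole sequence, which is then flattened.
  steps s t = simulate-base id (simulate (Closure⁺-rename FineRedex-rename) h s t)

-- Simulation of the rules

module _ {I : Set} where

  contract-≡ : ∀ {R r} {γ : I → Env k n} {M N N′} → r ∈ R → (s : Root r M N) →
               (∀ i → FineRoot (γ i) s) → N ≡ N′ → Closure (FineRedex R) γ M N′
  contract-≡ r∈R s f refl = root (contract r∈R s f)

  β⊃-root : ∀ {γ : I → Env k n} {M M′} → IPC.Root IPC.β⊃ M M′ → FineRedex ｛ β⊃ ｝ γ (M •) (M′ •)
  β⊃-root (IPC.β⊃ {A} {M} {N}) =
    subst (FineRedex _ _ _) (sym (•-[] M N)) (contract refl β⊃ _)

  η⊃-root : ∀ {γ : I → Env k n} {M M′} → IPC.Root IPC.η⊃ M M′ → FineRedex ｛ η⊃ ｝ γ (M •) (M′ •)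
  η⊃-root (IPC.η⊃ {A} {M}) =
    subst (λ N → FineRedex _ _ (ƛ (A •ᵗ) (N · var zero)) (M •)) (sym (•-ren suc M)) (contract refl η⊃ _)

  β∧-root : ∀ {γ : I → Env k n} {M M′} → IPC.Root IPC.β∧ M M′ → FineRedex ｛ β∧ ｝ γ (M •) (M′ •)
  β∧-root (IPC.β∧ 𝟏) = contract refl (β∧ 𝟏) _
  β∧-root (IPC.β∧ 𝟐) = contract refl (β∧ 𝟐) _

  η∧-root : ∀ {γ : I → Env k n} {M M′} → IPC.Root IPC.η∧ M M′ → FineRedex ｛ η∧ ｝ γ (M •) (M′ •)
  η∧-root IPC.η∧ = contract refl η∧ _

  -- The `Λ` and the `ƛ` of the injection consume `C` and the pair of branches, the projection
  -- selects a branch, and the last β-step feeds `M` to it.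
  case-in : ∀ {γ : I → Env k n} A B C P Q M i →
            Closure⁺ (FineRedex β) γ
              (in̲ i M A B ·ᵗ C · ⟨ ƛ A P , ƛ B Q ⟩) (pick i P Q F.[ M ])
  case-in {γ = γ} A B C P Q M i =
      ξ·ˡ (root (contract (inj₂ (inj₂ refl)) β∀ _))
    -- `M` was weakened in both sorts, so the two instantiations leave it unchanged.
    ∷ contract-≡ (inj₁ refl) β⊃ _ (cong (pair ·ᵖ i ·_)
        (trans (cong (sub (pair Sub.∷ var))
                 (trans (sym (ren-subᵗ suc _ (wkᵗ M))) (cong wk (subᵗ-cancel (λ _ → refl) M))))
               (wk-cancel pair M)))
    ∷ ξ·ˡ (root (contract (inj₂ (inj₁ refl)) (β∧ i) _))
    ∷ [ β-pick i ]
    where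
    pair = ⟨ ƛ A P , ƛ B Q ⟩
    β-pick : ∀ i → Closure (FineRedex β) γ (pick i (ƛ A P) (ƛ B Q) · M) (pick i P Q F.[ M ])
    β-pick 𝟏 = root (contract (inj₁ refl) β⊃ _)
    β-pick 𝟐 = root (contract (inj₁ refl) β⊃ _)

  -- The two δ-steps pull the `Λ` and the `ƛ` of the injections out of the branches. Each branch is
  -- then an η-expanded projection of the new variable, the pair of projections contracts to that
  -- variable, and what remains is an η-expansion of `M` by a term and a type argument.
  case-η : ∀ {γ : I → Env k n} A B M → (∀ i → γ i ⊢ M ∶ A ∨̲ B) →
           Closure⁺ (FineRedex (η ∪ ｛ δ ｝)) γ
             (M ·ᵗ (A ∨̲ B) · ⟨ ƛ A (in̲ 𝟏 (var zero) A B) , ƛ B (in̲ 𝟐 (var zero) A B) ⟩) M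
  case-η A B M d =
      root (contract (inj₂ refl) (δ∀ _ _ _ _ _) d)
    ∷ ξΛ (root (contract (inj₂ refl) (δ⊃ _ _ (body 𝟏) _ (body 𝟐)) (⊢wkᵗ ∘ d)))
    -- The exchange in `δ⊃` has moved the branch variable to index 0, so `swap (body 𝟏)` is
    -- literally of η-form.
    ∷ ξΛ (ξƛ (ξ·ʳ (ξ⟨,⟩ˡ (η⊃-step (var zero ·ᵖ 𝟏)))))
    ∷ ξΛ (ξƛ (ξ·ʳ (ξ⟨,⟩ʳ (η⊃-step (var zero ·ᵖ 𝟐)))))
    ∷ ξΛ (ξƛ (ξ·ʳ (root (contract (inj₁ (inj₂ (inj₁ refl))) η∧ _))))
    ∷ ξΛ (η⊃-step (wkᵗ M ·ᵗ var zero))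
    ∷ [ root (contract (inj₁ (inj₂ (inj₂ refl))) η∀ _) ]
    where
    body : ∀ {k n} → Index → Tm k (suc (suc n))
    body i = var zero ·ᵖ i · var (suc zero)
    η⊃-step : ∀ {k n} {γ : I → Env k n} {A} N →
              Closure (FineRedex (η ∪ ｛ δ ｝)) γ (ƛ A (wk N · var zero)) N
    η⊃-step N = root (contract (inj₁ (inj₁ refl)) η⊃ _)

-- Recording a target for each rule lets one proof, `simulate-root`, yield both the rule-by-rule
-- claims and, after widening, the global ones.
target : IPC.Rule → Pred Rule 0ℓ
target IPC.β⊃ = ｛ β⊃ ｝
target IPC.β∧ = ｛ β∧ ｝
target IPC.β∨ = β
target IPC.π⊃ = ｛ ε ｝
target IPC.π∧ = ｛ ε ｝
target IPC.π∨ = ｛ ε ｝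
target IPC.π⊥ = ｛ ε ｝
target IPC.ϖ⊃ = ｛ ϵ ｝
target IPC.ϖ∧ = ｛ ϵ ｝
target IPC.ϖ∨ = ｛ ϵ ｝
target IPC.ϖ⊥ = ｛ ϵ ｝
target IPC.η⊃ = ｛ η⊃ ｝
target IPC.η∧ = ｛ η∧ ｝
target IPC.η∨ = η ∪ ｛ δ ｝

module _ {I : Set} where

  simulate-root : ∀ {γ : I → IPC.Env k n} {r M M′} → IPC.Root r M M′ → Typed γ M →
                  Closure⁺ (FineRedex (target r)) (_•ᵉ ∘ γ) (M •) (M′ •)
  simulate-root s@IPC.β⊃     t = [ root (β⊃-root s) ]
  simulate-root s@(IPC.β∧ _) t = [ root (β∧-root s) ]
  simulate-root s@IPC.η⊃     t = [ root (η⊃-root s) ]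
  simulate-root s@IPC.η∧     t = [ root (η∧-root s) ]
  simulate-root (IPC.β∨ {A₁} {A₂} {M} {P₁} {P₂} {C} i) t =
    subst (Closure⁺ _ _ _) (sym (pick-[] i))
      (case-in (A₁ •ᵗ) (A₂ •ᵗ) (C •ᵗ) (P₁ •) (P₂ •) (M •) i)
    where
    pick-[] : ∀ i → (pick i P₁ P₂ IPC.[ M ]) • ≡ pick i (P₁ •) (P₂ •) F.[ M • ]
    pick-[] 𝟏 = •-[] P₁ M
    pick-[] 𝟐 = •-[] P₂ M
  simulate-root (IPC.η∨ {A} {B} {M}) t =
    case-η (A •ᵗ) (B •ᵗ) (M •) λ i → case t i of λ { (_ , IPC.⊢case d _ _) → ⊢• d }
  simulate-root (IPC.π⊃ {N = N}) t =
    [ contract-≡ refl (ε⊃ _ _ _ _ _)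
        (λ i → case t i of λ { (_ , IPC.⊢· (IPC.⊢case d _ _) _) → ⊢• d })
        (cong (λ N → _ ·ᵗ _ · ⟨ ƛ _ (_ · N) , ƛ _ (_ · N) ⟩) (sym (•-ren suc N))) ]
  simulate-root (IPC.π∧ 𝟏) t =
    [ root (contract refl (ε∧ _ _ _ _ _ 𝟏)
        λ i → case t i of λ { (_ , IPC.⊢·ᵖ _ (IPC.⊢case d _ _)) → ⊢• d }) ]
  simulate-root (IPC.π∧ 𝟐) t =
    [ root (contract refl (ε∧ _ _ _ _ _ 𝟐)
        λ i → case t i of λ { (_ , IPC.⊢·ᵖ _ (IPC.⊢case d _ _)) → ⊢• d }) ]
  simulate-root (IPC.π∨ {P = P} {Q}) t =
      -- Absorbing the type argument instantiates the encoded disjunction to an implication with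
      -- codomain `E •ᵗ`, so `ε⊃` can absorb the pair of outer branches next. The head term is the
      -- same in both steps.
      ξ·ˡ (root (contract refl (ε∀ _ _ _ _ _ _) f))
    ∷ [ contract-≡ refl (ε⊃ _ _ _ _ _) f
          (cong₂ (λ P Q → _ ·ᵗ _ · ⟨ ƛ _ (_ ·ᵗ _ · ⟨ ƛ _ P , ƛ _ Q ⟩)
                                   , ƛ _ (_ ·ᵗ _ · ⟨ ƛ _ P , ƛ _ Q ⟩) ⟩)
            (sym (•-ren (lift 1 suc) P)) (sym (•-ren (lift 1 suc) Q))) ]
    where
    f = λ i → case t i of λ { (_ , IPC.⊢case (IPC.⊢case d _ _) _ _) → ⊢• d }
  simulate-root IPC.π⊥ t =
    -- One step suffices, since `⊥̲` instantiated at a type is that type.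
    [ root (contract refl (ε∀ _ _ _ _ _ _)
        λ i → case t i of λ { (_ , IPC.⊢abort (IPC.⊢case d _ _)) → ⊢• d }) ]
  simulate-root IPC.ϖ⊃ t =
    [ root (contract refl (ϵ⊃ _)
        λ i → case t i of λ { (_ , IPC.⊢· (IPC.⊢abort d) _) → ⊢• d }) ]
  simulate-root (IPC.ϖ∧ 𝟏) t =
    [ root (contract refl (ϵ∧ _ 𝟏)
        λ i → case t i of λ { (_ , IPC.⊢·ᵖ _ (IPC.⊢abort d)) → ⊢• d }) ]
  simulate-root (IPC.ϖ∧ 𝟐) t =
    [ root (contract refl (ϵ∧ _ 𝟐)
        λ i → case t i of λ { (_ , IPC.⊢·ᵖ _ (IPC.⊢abort d)) → ⊢• d }) ]
  simulate-root IPC.ϖ∨ t =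
      ξ·ˡ (root (contract refl (ϵ∀ _ _) f))
    ∷ [ root (contract refl (ϵ⊃ _) f) ]
    where
    f = λ i → case t i of λ { (_ , IPC.⊢case (IPC.⊢abort d) _ _) → ⊢• d }
  simulate-root IPC.ϖ⊥ t =
    [ root (contract refl (ϵ∀ _ _)
        λ i → case t i of λ { (_ , IPC.⊢abort (IPC.⊢abort d)) → ⊢• d }) ]

-- Deriving ε, ϵ and δ from ϱ, ρ and β

commuting atomizing : Pred Rule 0ℓ
commuting = β ∪ η ∪ ｛ ε ｝ ∪ ｛ ϵ ｝ ∪ ｛ δ ｝
atomizing = β ∪ η ∪ ｛ ϱ ｝ ∪ ｛ ρ ｝

target⊆commuting : ∀ r → target r ⊆ commuting
target⊆commuting IPC.β⊃ refl = inj₁ (inj₁ refl)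
target⊆commuting IPC.β∧ refl = inj₁ (inj₂ (inj₁ refl))
target⊆commuting IPC.β∨ p    = inj₁ p
target⊆commuting IPC.π⊃ p    = inj₂ (inj₂ (inj₁ p))
target⊆commuting IPC.π∧ p    = inj₂ (inj₂ (inj₁ p))
target⊆commuting IPC.π∨ p    = inj₂ (inj₂ (inj₁ p))
target⊆commuting IPC.π⊥ p    = inj₂ (inj₂ (inj₁ p))
target⊆commuting IPC.ϖ⊃ p    = inj₂ (inj₂ (inj₂ (inj₁ p)))
target⊆commuting IPC.ϖ∧ p    = inj₂ (inj₂ (inj₂ (inj₁ p)))
target⊆commuting IPC.ϖ∨ p    = inj₂ (inj₂ (inj₂ (inj₁ p)))
target⊆commuting IPC.ϖ⊥ p    = inj₂ (inj₂ (inj₂ (inj₁ p)))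
target⊆commuting IPC.η⊃ refl = inj₂ (inj₁ (inj₁ refl))
target⊆commuting IPC.η∧ refl = inj₂ (inj₁ (inj₂ (inj₁ refl)))
target⊆commuting IPC.η∨ (inj₁ p) = inj₂ (inj₁ p)
target⊆commuting IPC.η∨ (inj₂ p) = inj₂ (inj₂ (inj₂ (inj₂ p)))

module _ {I : Set} where

  widen : ∀ {R R′} → R ⊆ R′ → ∀ {γ : I → Env k n} {M M′} →
          FineRedex R γ M M′ → Closure⁺ (FineRedex R′) γ M M′
  widen R⊆R′ (contract r∈R s f) = [ root (contract (R⊆R′ r∈R) s f) ]

  pattern β⊃∈ = inj₁ (inj₁ refl)
  pattern β∧∈ = inj₁ (inj₂ (inj₁ refl))
  pattern β∀∈ = inj₁ (inj₂ (inj₂ refl))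
  pattern ϱ∈  = inj₂ (inj₂ (inj₁ refl))
  pattern ρ∈  = inj₂ (inj₂ (inj₂ refl))

  -- This redex is what `ϱ⊃` leaves in a branch of a `δ⊃`-redex. Substituting index 1 for index 0
  -- after `wk₁` sends 0 to 1, 1 to 0, and fixes the rest.
  β-swap : ∀ {γ : I → Env k (suc (suc n))} {C} P →
           Closure (FineRedex atomizing) γ (wk₁ (ƛ C P) · var (suc zero)) (swap P)
  β-swap P = contract-≡ β⊃∈ β⊃ _
    (sub-ren (λ { zero → refl ; (suc zero) → refl ; (suc (suc x)) → refl }) P)

  β∀-wkᵗ : ∀ {γ : I → Env (suc k) n} P →
           Closure (FineRedex atomizing) γ (wkᵗ (Λ P) ·ᵗ var zero) P
  β∀-wkᵗ P = contract-≡ β∀∈ β∀ _ (subᵗ-cancel (λ { zero → refl ; (suc x) → refl }) P)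

  -- The ϱ- or ρ-step has the same head term and the same annotations as the step it replaces, so
  -- the fineness proof `f` is reused as it is; the β-steps that follow are fine everywhere.
  commuting⇒atomizing : ∀ {γ : I → Env k n} {M M′} →
                        FineRedex commuting γ M M′ → Closure⁺ (FineRedex atomizing) γ M M′
  commuting⇒atomizing (contract (inj₁ p) s f)        = [ root (contract (inj₁ p) s f) ]
  commuting⇒atomizing (contract (inj₂ (inj₁ p)) s f) = [ root (contract (inj₂ (inj₁ p)) s f) ]
  commuting⇒atomizing (contract (inj₂ (inj₂ (inj₁ refl))) (ε⊃ {C₁} {C₂} M A P B Q {N}) f) =
      ξ·ˡ (root (contract ϱ∈ (ϱ⊃ _ _ _ _ _) f))
    ∷ [ contract-≡ β⊃∈ β⊃ _
          (cong₂ (λ M N → M ·ᵗ C₂ · N) (wk-cancel N M)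
            (cong₂ (λ P Q → ⟨ ƛ A (P · wk N) , ƛ B (Q · wk N) ⟩)
              (wk₁-cancel N P) (wk₁-cancel N Q))) ]
  commuting⇒atomizing (contract (inj₂ (inj₂ (inj₁ refl))) (ε∧ M A P B Q 𝟏) f) =
    ξ·ᵖ (root (contract ϱ∈ (ϱ∧ _ _ _ _ _) f)) ∷ [ root (contract β∧∈ (β∧ 𝟏) _) ]
  commuting⇒atomizing (contract (inj₂ (inj₂ (inj₁ refl))) (ε∧ M A P B Q 𝟐) f) =
    ξ·ᵖ (root (contract ϱ∈ (ϱ∧ _ _ _ _ _) f)) ∷ [ root (contract β∧∈ (β∧ 𝟐) _) ]
  commuting⇒atomizing (contract (inj₂ (inj₂ (inj₁ refl))) (ε∀ {C′} M A P B Q C″) f) =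
      ξ·ᵗ (root (contract ϱ∈ (ϱ∀ _ _ _ _ _) f))
    ∷ [ contract-≡ β∀∈ β∀ _
          (cong₂ (λ M N → M ·ᵗ (C′ [ C″ ]Ty) · N) (cancel M)
            (cong₂ ⟨_,_⟩
              (cong₂ (λ A P → ƛ A (P ·ᵗ C″)) (cancelTy A) (cancel P))
              (cong₂ (λ B Q → ƛ B (Q ·ᵗ C″)) (cancelTy B) (cancel Q)))) ]
    where
    cancelTy = subTy-cancel {τ = C″ Sub.∷ var} (λ _ → refl)
    cancel : ∀ {n} (M : Tm _ n) → wkᵗ M [ C″ ]ᵗ ≡ M
    cancel = subᵗ-cancel (λ _ → refl)
  commuting⇒atomizing (contract (inj₂ (inj₂ (inj₂ (inj₁ refl)))) (ϵ⊃ {C₁} {C₂} M {N}) f) =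
      ξ·ˡ (root (contract ρ∈ (ρ⊃ _) f))
    ∷ [ contract-≡ β⊃∈ β⊃ _ (cong (_·ᵗ C₂) (wk-cancel N M)) ]
  commuting⇒atomizing (contract (inj₂ (inj₂ (inj₂ (inj₁ refl)))) (ϵ∧ M 𝟏) f) =
    ξ·ᵖ (root (contract ρ∈ (ρ∧ _) f)) ∷ [ root (contract β∧∈ (β∧ 𝟏) _) ]
  commuting⇒atomizing (contract (inj₂ (inj₂ (inj₂ (inj₁ refl)))) (ϵ∧ M 𝟐) f) =
    ξ·ᵖ (root (contract ρ∈ (ρ∧ _) f)) ∷ [ root (contract β∧∈ (β∧ 𝟐) _) ]
  commuting⇒atomizing (contract (inj₂ (inj₂ (inj₂ (inj₁ refl)))) (ϵ∀ {C′} M C″) f) =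
      ξ·ᵗ (root (contract ρ∈ (ρ∀ _) f))
    ∷ [ contract-≡ β∀∈ β∀ _ (cong (_·ᵗ (C′ [ C″ ]Ty)) (subᵗ-cancel (λ _ → refl) M)) ]
  commuting⇒atomizing (contract (inj₂ (inj₂ (inj₂ (inj₂ refl)))) (δ⊃ M A P B Q) f) =
      root (contract ϱ∈ (ϱ⊃ _ _ _ _ _) f)
    ∷ ξƛ (ξ·ʳ (ξ⟨,⟩ˡ (ξƛ (β-swap P))))
    ∷ [ ξƛ (ξ·ʳ (ξ⟨,⟩ʳ (ξƛ (β-swap Q)))) ]
  commuting⇒atomizing (contract (inj₂ (inj₂ (inj₂ (inj₂ refl)))) (δ∧ M A P₁ P₂ B Q₁ Q₂) f) =
      root (contract ϱ∈ (ϱ∧ _ _ _ _ _) f)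
    ∷ ξ⟨,⟩ˡ (ξ·ʳ (ξ⟨,⟩ˡ (ξƛ (root (contract β∧∈ (β∧ 𝟏) _)))))
    ∷ ξ⟨,⟩ˡ (ξ·ʳ (ξ⟨,⟩ʳ (ξƛ (root (contract β∧∈ (β∧ 𝟏) _)))))
    ∷ ξ⟨,⟩ʳ (ξ·ʳ (ξ⟨,⟩ˡ (ξƛ (root (contract β∧∈ (β∧ 𝟐) _)))))
    ∷ [ ξ⟨,⟩ʳ (ξ·ʳ (ξ⟨,⟩ʳ (ξƛ (root (contract β∧∈ (β∧ 𝟐) _))))) ]
  commuting⇒atomizing (contract (inj₂ (inj₂ (inj₂ (inj₂ refl)))) (δ∀ M A P B Q) f) =
      root (contract ϱ∈ (ϱ∀ _ _ _ _ _) f)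
    ∷ ξΛ (ξ·ʳ (ξ⟨,⟩ˡ (ξƛ (β∀-wkᵗ P))))
    ∷ [ ξΛ (ξ·ʳ (ξ⟨,⟩ʳ (ξƛ (β∀-wkᵗ Q)))) ]

  simulate-commuting : ∀ {γ : I → IPC.Env k n} {r M M′} → IPC.Root r M M′ → Typed γ M →
                       Closure⁺ (FineRedex commuting) (_•ᵉ ∘ γ) (M •) (M′ •)
  simulate-commuting {r = r} s t =
    simulate-base⁺ (widen (target⊆commuting r)) (simulate-root s t)

  simulate-atomizing : ∀ {γ : I → IPC.Env k n} {r M M′} → IPC.Root r M M′ → Typed γ M →
                       Closure⁺ (FineRedex atomizing) (_•ᵉ ∘ γ) (M •) (M′ •)
  simulate-atomizing s t = simulate-base⁺ commuting⇒atomizing (simulate-commuting s t)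

simulated-rule : ∀ r {M M′ : IPC.Tm k n} → M IPC.⟶[ ｛ r ｝ ] M′ → Simulated⁺ (target r) M M′
simulated-rule r = simulated⁺ λ { refl → simulate-root }

theorem1 : ∀ {k n : ℕ} (M₁ M₂ : IPC.Tm k n) →
    (M₁ IPC.⟶ M₂ →
    Simulated⁺ (F.β ∪ F.η ∪ ｛ F.ε ｝ ∪ ｛ F.ϵ ｝ ∪ ｛ F.δ ｝) M₁ M₂
    × Simulated⁺ (F.β ∪ F.η ∪ ｛ F.ϱ ｝ ∪ ｛ F.ρ ｝) M₁ M₂)
    × ((M₁ IPC.⟶[ ｛ IPC.β⊃ ｝ ] M₂ → Simulated ｛ F.β⊃ ｝ M₁ M₂)
    × (M₁ IPC.⟶[ ｛ IPC.η⊃ ｝ ] M₂ → Simulated ｛ F.η⊃ ｝ M₁ M₂)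
    × (M₁ IPC.⟶[ ｛ IPC.β∧ ｝ ] M₂ → Simulated ｛ F.β∧ ｝ M₁ M₂)
    × (M₁ IPC.⟶[ ｛ IPC.η∧ ｝ ] M₂ → Simulated ｛ F.η∧ ｝ M₁ M₂))
    × (M₁ IPC.⟶[ ｛ IPC.β∨ ｝ ] M₂ → Simulated⁺ F.β M₁ M₂)
    × (M₁ IPC.⟶[ ｛ IPC.η∨ ｝ ] M₂ → Simulated⁺ (F.η ∪ ｛ F.δ ｝) M₁ M₂)
    × (∀ r → r ∈ IPC.π → M₁ IPC.⟶[ ｛ r ｝ ] M₂ → Simulated⁺ ｛ F.ε ｝ M₁ M₂)
    × (∀ r → r ∈ IPC.ϖ → M₁ IPC.⟶[ ｛ r ｝ ] M₂ → Simulated⁺ ｛ F.ϵ ｝ M₁ M₂)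
theorem1 M₁ M₂ =
    (λ s → simulated⁺ (λ _ → simulate-commuting) s , simulated⁺ (λ _ → simulate-atomizing) s)
  , ( simulated (λ { refl s _ → β⊃-root s })
    , simulated (λ { refl s _ → η⊃-root s })
    , simulated (λ { refl s _ → β∧-root s })
    , simulated (λ { refl s _ → η∧-root s }))
  , simulated-rule IPC.β∨
  , simulated-rule IPC.η∨
  -- Matching on the membership proof determines `r`, which lets `target r` compute to the
  -- singleton.
  , (λ { r (inj₁ refl)               → simulated-rule r
       ; r (inj₂ (inj₁ refl))        → simulated-rule r
       ; r (inj₂ (inj₂ (inj₁ refl))) → simulated-rule r
       ; r (inj₂ (inj₂ (inj₂ refl))) → simulated-rule r })
  , (λ { r (inj₁ refl)               → simulated-rule r
       ; r (inj₂ (inj₁ refl))        → simulated-rule r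
       ; r (inj₂ (inj₂ (inj₁ refl))) → simulated-rule r
       ; r (inj₂ (inj₂ (inj₂ refl))) → simulated-rule r })
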